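{- Let $\mathsf L$ be a canonical normal modal logic in the basic modal language such that $\mathsf{Fr}(\mathsf L)$ admits filtration. Then $\mu_c$-$\mathsf L$ is sound and complete with respect to $\mathsf{Fr}(\mathsf L)$: for every $\mu_c\mathsf{ML}$-formula $\varphi$, $\mu_c$-$\mathsf L\vdash\varphi$ if and only if $\varphi$ is valid in every frame of $\mathsf{Fr}(\mathsf L)$.
   Context: Syntax: over a countably infinite set $\mathsf P$ of variables, $\mu_c\mathsf{ML}$ consists of $p\mid\neg p\mid\varphi\lor\varphi\mid\varphi\land\varphi\mid\Diamond\varphi\mid\Box\varphi\mid\mu x.\varphi'\mid\nu x.\varphi''$ with $\varphi'\in\mathsf{Con}_{\{x\}}$, $\varphi''\in\mathsf{Cocon}_{\{x\}}$, where $\mathsf{Con}_X$ is generated by $x\in X$, $X$-free $\mu_c\mathsf{ML}$-formulas, $\lor,\land,\Diamond$ and $\mu y.\varphi'$ with $\varphi'\in\mathsf{Con}_{X\cup\{y\}}$, and $\mathsf{Cocon}_X$ dually with $\Box,\nu$. Kripke semantics is standard ($\mu,\nu$ least/greatest fixpoints); a formula is valid in a frame $(S,R)$ if it is true at every state of $(S,R,V)$ for every valuation $V$. $\mathsf{Fr}(\mathsf L)$ is the class of frames in which every formula of $\mathsf L$ is valid. $\mathsf L$ is canonical if its canonical frame (maximally $\mathsf L$-consistent sets of basic modal formulas, with $\Gamma R\Delta$ iff $\Box\varphi\in\Gamma\Rightarrow\varphi\in\Delta$) belongs to $\mathsf{Fr}(\mathsf L)$. Negation ${\sim}$ is the usual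 negation-normal-form negation with ${\sim}\eta x.\varphi=\overline\eta x.{\sim}\varphi[\neg x/x]$; $\varphi\to\psi$ abbreviates ${\sim}\varphi\lor\psi$. $\mu_c\mathsf K$ is the least set of formulas containing a complete axiomatisation of propositional logic, $\neg\Diamond\bot$, $\Diamond(p\lor q)\leftrightarrow(\Diamond p\lor\Diamond q)$, the prefixpoint axioms $\varphi[\mu x.\varphi/x]\to\mu x.\varphi$ for $\varphi\in\mathsf{Con}_{\{x\}}$, and closed under modus ponens, monotonicity (from $\varphi\to\psi$ derive $\Diamond\varphi\to\Diamond\psi$), uniform substitution and the least prefixpoint rule (from $\varphi[\gamma/x]\to\gamma$ with $\varphi\in\mathsf{Con}_{\{x\}}$ derive $\mu x.\varphi\to\gamma$), together with dual versions and rules expressing the duality of $\Diamond/\Box$ and $\mu/\nu$. A $\mu_c$-logic is an axiomatic extension of $\mu_c\mathsf K$ closed under these rules; $\mu_c$-$\mathsf L$ is the least $\mu_c$-logic containing $\mathsf L$. Filtration: FL-closure of $\Phi$ is the least $\Psi\supseteq\Phi$ closed under $\neg p\mapsto p$, $\varphi\circ\psi\mapsto\varphi,\psi$, $\heartsuit\varphi\mapsto\varphi$, $\eta x.\varphi\mapsto\varphi[\eta x.\varphi/x]$. For finite FL-closed $\Sigma$ and model $\mathbb S=(S,R,V)$, $s\sim_\Sigma s'$ iff they satisfy the same formulas of $\Sigma$; a filtration of $\mathbb S$ through $\Sigma$ is a model $(S/{\sim_\Sigma},R^\Sigma,V^\Sigma)$ with $R^{\min}\subseteq R^\Sigma\subseteq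 R^{\max}$ ($\overline sR^{\min}\overline t$ iff $Rs't'$ for some $s'\sim_\Sigma s,t'\sim_\Sigma t$; $\overline sR^{\max}\overline t$ iff for all $\Box\varphi\in\Sigma$, $s\Vdash\Box\varphi\Rightarrow t\Vdash\varphi$) and $V^\Sigma(p)=\{\overline s:s\Vdash p\}$ for $p\in\Sigma$. A class of frames $\mathcal F$ admits filtration if for every model whose underlying frame is in $\mathcal F$ and every finite FL-closed set $\Sigma$ of basic modal formulas, there is a filtration of that model through $\Sigma$ whose underlying frame is in $\mathcal F$. -}

module Defs where

open import Data.Nat using (ℕ; zero; suc)
open import Data.Bool using (Bool; true; false; not; if_then_else_; T)
  renaming (_∨_ to _∨ᵇ_; _∧_ to _∧ᵇ_)
open import Data.Product using (Σ; _×_; _,_; ∃; proj₁)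
open import Data.List using (List; []; _∷_)
open import Data.List.Membership.Propositional using (_∈_)
open import Data.List.Relation.Unary.All using (All)
open import Relation.Nullary using (Dec; does; ¬_)
open import Relation.Binary.PropositionalEquality using (_≡_)
open import Function.Bundles using (_⇔_)

-- Syntax (de Bruijn indices; the countable variable set P is ℕ).
-- A free variable p_i under k binders is written var (i + k).

infixr 6 _∧ᶠ_
infixr 5 _∨ᶠ_
infixr 4 _⇒_
infix 3 _⇔ᶠ_

data Fm : Set where
  var nvar   : ℕ → Fm
  _∨ᶠ_ _∧ᶠ_  : Fm → Fm → Fm
  ◇_ □_      : Fm → Fm
  μ_ ν_      : Fm → Fm         -- binds index 0

extB : (ℕ → Bool) → ℕ → Bool
extB X zero    = true
extB X (suc i) = X i

only0 : ℕ → Bool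
only0 = extB (λ _ → false)

data Occ : ℕ → Fm → Set where
  ovar  : ∀ {i} → Occ i (var i)
  onvar : ∀ {i} → Occ i (nvar i)
  oorl  : ∀ {i a b} → Occ i a → Occ i (a ∨ᶠ b)
  oorr  : ∀ {i a b} → Occ i b → Occ i (a ∨ᶠ b)
  oandl : ∀ {i a b} → Occ i a → Occ i (a ∧ᶠ b)
  oandr : ∀ {i a b} → Occ i b → Occ i (a ∧ᶠ b)
  odia  : ∀ {i a} → Occ i a → Occ i (◇ a)
  obox  : ∀ {i a} → Occ i a → Occ i (□ a)
  omu   : ∀ {i a} → Occ (suc i) a → Occ i (μ a)
  onu   : ∀ {i a} → Occ (suc i) a → Occ i (ν a)

Free : (ℕ → Bool) → Fm → Set
Free X φ = ∀ i → Occ i φ → X i ≡ false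

mutual
  data WF : Fm → Set where
    wvar  : ∀ {i} → WF (var i)
    wnvar : ∀ {i} → WF (nvar i)
    wor   : ∀ {a b} → WF a → WF b → WF (a ∨ᶠ b)
    wand  : ∀ {a b} → WF a → WF b → WF (a ∧ᶠ b)
    wdia  : ∀ {a} → WF a → WF (◇ a)
    wbox  : ∀ {a} → WF a → WF (□ a)
    wmu   : ∀ {a} → Con only0 a → WF (μ a)
    wnu   : ∀ {a} → Cocon only0 a → WF (ν a)

  data Con (X : ℕ → Bool) : Fm → Set where
    cvar  : ∀ {i} → X i ≡ true → Con X (var i)
    cfree : ∀ {a} → WF a → Free X a → Con X a
    cor   : ∀ {a b} → Con X a → Con X b → Con X (a ∨ᶠ b)
    cand  : ∀ {a b} → Con X a → Con X b → Con X (a ∧ᶠ b)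
    cdia  : ∀ {a} → Con X a → Con X (◇ a)
    cmu   : ∀ {a} → Con (extB X) a → Con X (μ a)

  data Cocon (X : ℕ → Bool) : Fm → Set where
    kvar  : ∀ {i} → X i ≡ true → Cocon X (var i)
    kfree : ∀ {a} → WF a → Free X a → Cocon X a
    kor   : ∀ {a b} → Cocon X a → Cocon X b → Cocon X (a ∨ᶠ b)
    kand  : ∀ {a b} → Cocon X a → Cocon X b → Cocon X (a ∧ᶠ b)
    kbox  : ∀ {a} → Cocon X a → Cocon X (□ a)
    knu   : ∀ {a} → Cocon (extB X) a → Cocon X (ν a)

data Basic : Fm → Set where
  bvar  : ∀ {i} → Basic (var i)
  bnvar : ∀ {i} → Basic (nvar i)
  bor   : ∀ {a b} → Basic a → Basic b → Basic (a ∨ᶠ b)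
  band  : ∀ {a b} → Basic a → Basic b → Basic (a ∧ᶠ b)
  bdia  : ∀ {a} → Basic a → Basic (◇ a)
  bbox  : ∀ {a} → Basic a → Basic (□ a)

-- Negation normal form negation ~.  negK K φ negates φ while keeping the
-- literals of the indices in K (bound variables of negated fixpoints):
-- this implements  ~ηx.φ = η̄x.~φ[¬x/x]  (x ↦ ¬x followed by ¬¬x = x).

negK : (ℕ → Bool) → Fm → Fm
negK K (var i)  = if K i then var i else nvar i
negK K (nvar i) = if K i then nvar i else var i
negK K (a ∨ᶠ b) = negK K a ∧ᶠ negK K b
negK K (a ∧ᶠ b) = negK K a ∨ᶠ negK K b
negK K (◇ a)    = □ negK K a
negK K (□ a)    = ◇ negK K a
negK K (μ a)    = ν negK (extB K) a
negK K (ν a)    = μ negK (extB K) a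

~_ : Fm → Fm
~ φ = negK (λ _ → false) φ

_⇒_ : Fm → Fm → Fm
a ⇒ b = ~ a ∨ᶠ b

_⇔ᶠ_ : Fm → Fm → Fm
a ⇔ᶠ b = (a ⇒ b) ∧ᶠ (b ⇒ a)

pv qv : Fm
pv = var 0
qv = var 1

-- ⊥ is not primitive in the syntax; we take ⊥ := p ∧ ¬p, ⊤ := ~⊥
⊥ᶠ ⊤ᶠ : Fm
⊥ᶠ = pv ∧ᶠ nvar 0
⊤ᶠ = ~ ⊥ᶠ

liftR : (ℕ → ℕ) → ℕ → ℕ
liftR r zero    = zero
liftR r (suc i) = suc (r i)

ren : (ℕ → ℕ) → Fm → Fm
ren r (var i)  = var (r i)
ren r (nvar i) = nvar (r i)
ren r (a ∨ᶠ b) = ren r a ∨ᶠ ren r b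
ren r (a ∧ᶠ b) = ren r a ∧ᶠ ren r b
ren r (◇ a)    = ◇ ren r a
ren r (□ a)    = □ ren r a
ren r (μ a)    = μ ren (liftR r) a
ren r (ν a)    = ν ren (liftR r) a

liftS : (ℕ → Fm) → ℕ → Fm
liftS σ zero    = var zero
liftS σ (suc i) = ren suc (σ i)

sub : (ℕ → Fm) → Fm → Fm
sub σ (var i)  = σ i
sub σ (nvar i) = ~ σ i
sub σ (a ∨ᶠ b) = sub σ a ∨ᶠ sub σ b
sub σ (a ∧ᶠ b) = sub σ a ∧ᶠ sub σ b
sub σ (◇ a)    = ◇ sub σ a
sub σ (□ a)    = □ sub σ a
sub σ (μ a)    = μ sub (liftS σ) a
sub σ (ν a)    = ν sub (liftS σ) a

sub0 : Fm → ℕ → Fm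
sub0 γ zero    = γ
sub0 γ (suc i) = var i

_[_/0] : Fm → Fm → Fm
φ [ γ /0] = sub (sub0 γ) φ

pval : (Fm → Bool) → Fm → Bool
pval v (a ∨ᶠ b) = pval v a ∨ᵇ pval v b
pval v (a ∧ᶠ b) = pval v a ∧ᵇ pval v b
pval v φ        = v φ

Taut : Fm → Set
Taut φ = (v : Fm → Bool) → (∀ ψ → v (~ ψ) ≡ not (v ψ)) → T (pval v φ)

infix 2 _⊢_

data _⊢_ (L : Fm → Set) : Fm → Set where
  ax       : ∀ {φ} → L φ → L ⊢ φ
  taut     : ∀ {φ} → WF φ → Taut φ → L ⊢ φ
  ax-◇⊥    : L ⊢ ~ (◇ ⊥ᶠ)
  ax-◇∨    : L ⊢ ◇ (pv ∨ᶠ qv) ⇔ᶠ (◇ pv ∨ᶠ ◇ qv)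
  ax-□⊤    : L ⊢ □ ⊤ᶠ
  ax-□∧    : L ⊢ □ (pv ∧ᶠ qv) ⇔ᶠ (□ pv ∧ᶠ □ qv)
  ax-pre   : ∀ {φ} → Con only0 φ → L ⊢ (φ [ μ φ /0] ⇒ μ φ)
  ax-post  : ∀ {φ} → Cocon only0 φ → L ⊢ (ν φ ⇒ φ [ ν φ /0])
  mp       : ∀ {φ ψ} → L ⊢ φ → L ⊢ (φ ⇒ ψ) → L ⊢ ψ
  mono◇    : ∀ {φ ψ} → L ⊢ (φ ⇒ ψ) → L ⊢ (◇ φ ⇒ ◇ ψ)
  mono□    : ∀ {φ ψ} → L ⊢ (φ ⇒ ψ) → L ⊢ (□ φ ⇒ □ ψ)
  usub     : ∀ {φ} (σ : ℕ → Fm) → (∀ i → WF (σ i)) → L ⊢ φ → L ⊢ sub σ φ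
  lfp      : ∀ {φ γ} → Con only0 φ → WF γ →
             L ⊢ (φ [ γ /0] ⇒ γ) → L ⊢ (μ φ ⇒ γ)
  gfp      : ∀ {φ γ} → Cocon only0 φ → WF γ →
             L ⊢ (γ ⇒ φ [ γ /0]) → L ⊢ (γ ⇒ ν φ)

record NormalModalLogic (L : Fm → Set) : Set where
  field
    basic : ∀ φ → L φ → Basic φ
    tauts : ∀ φ → Basic φ → Taut φ → L φ
    K     : L (□ (pv ⇒ qv) ⇒ (□ pv ⇒ □ qv))
    mpL   : ∀ φ ψ → L φ → L (φ ⇒ ψ) → L ψ
    nec   : ∀ φ → L φ → L (□ φ)
    usubL : ∀ (σ : ℕ → Fm) φ → (∀ i → Basic (σ i)) → L φ → L (sub σ φ)

-- Kripke semantics.  Metatheory is classical: LEM is passed explicitly and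
-- subsets are Bool-valued predicates.

LEM : Set₁
LEM = (A : Set) → Dec A

record Frame : Set₁ where
  constructor frame
  field
    St  : Set
    Rel : St → St → Set
open Frame public

_∷ₑ_ : {S : Set} → (S → Bool) → (ℕ → S → Bool) → ℕ → S → Bool
(X ∷ₑ ρ) zero    = X
(X ∷ₑ ρ) (suc i) = ρ i

eval : LEM → (F : Frame) → Fm → (ℕ → St F → Bool) → St F → Bool
eval lem F (var i)  ρ s = ρ i s
eval lem F (nvar i) ρ s = not (ρ i s)
eval lem F (a ∨ᶠ b) ρ s = eval lem F a ρ s ∨ᵇ eval lem F b ρ s
eval lem F (a ∧ᶠ b) ρ s = eval lem F a ρ s ∧ᵇ eval lem F b ρ s
eval lem F (◇ a)    ρ s =
  does (lem (Σ (St F) λ t → Rel F s t × T (eval lem F a ρ t)))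
eval lem F (□ a)    ρ s =
  does (lem ((t : St F) → Rel F s t → T (eval lem F a ρ t)))
eval lem F (μ a)    ρ s =
  does (lem ((X : St F → Bool) →
             ((t : St F) → T (eval lem F a (X ∷ₑ ρ) t) → T (X t)) → T (X s)))
eval lem F (ν a)    ρ s =
  does (lem (Σ (St F → Bool) λ X →
             ((t : St F) → T (X t) → T (eval lem F a (X ∷ₑ ρ) t)) × T (X s)))

Valid : LEM → Frame → Fm → Set
Valid lem F φ = (V : ℕ → St F → Bool) (s : St F) → T (eval lem F φ V s)

InFr : LEM → (Fm → Set) → Frame → Set
InFr lem L F = (φ : Fm) → L φ → Valid lem F φ

conj : List Fm → Fm
conj []       = ⊤ᶠ
conj (φ ∷ xs) = φ ∧ᶠ conj xs

Consistent : (Fm → Set) → (Fm → Bool) → Set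
Consistent L Γ = (xs : List Fm) → All (λ φ → T (Γ φ)) xs → ¬ L (~ conj xs)

BasicSet : (Fm → Bool) → Set
BasicSet Γ = ∀ φ → T (Γ φ) → Basic φ

MaxConsistent : (Fm → Set) → (Fm → Bool) → Set
MaxConsistent L Γ =
  BasicSet Γ × Consistent L Γ ×
  ((Δ : Fm → Bool) → (∀ φ → T (Γ φ) → T (Δ φ)) → BasicSet Δ →
     Consistent L Δ → ∀ φ → T (Δ φ) → T (Γ φ))

CanonicalFrame : (Fm → Set) → Frame
CanonicalFrame L =
  frame (Σ (Fm → Bool) (MaxConsistent L))
        (λ Γ Δ → ∀ φ → T (proj₁ Γ (□ φ)) → T (proj₁ Δ φ))

Canonical : LEM → (Fm → Set) → Set
Canonical lem L = InFr lem L (CanonicalFrame L)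

FLchildren : Fm → List Fm
FLchildren (var i)  = []
FLchildren (nvar i) = var i ∷ []
FLchildren (a ∨ᶠ b) = a ∷ b ∷ []
FLchildren (a ∧ᶠ b) = a ∷ b ∷ []
FLchildren (◇ a)    = a ∷ []
FLchildren (□ a)    = a ∷ []
FLchildren (μ a)    = (a [ μ a /0]) ∷ []
FLchildren (ν a)    = (a [ ν a /0]) ∷ []

FLClosed : List Fm → Set
FLClosed Σs = ∀ φ → φ ∈ Σs → All (_∈ Σs) (FLchildren φ)

SameΣ : LEM → (F : Frame) → (ℕ → St F → Bool) → List Fm → St F → St F → Set
SameΣ lem F V Σs s s' = ∀ φ → φ ∈ Σs → eval lem F φ V s ≡ eval lem F φ V s'

-- A filtration of (F,V) through Σ.  The quotient S/∼_Σ is given as a type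
-- Q with a surjection q : S → Q whose kernel is ∼_Σ (s̄ = q s).
record Filtration (lem : LEM) (F : Frame) (V : ℕ → St F → Bool)
                  (Σs : List Fm) : Set₁ where
  field
    Q      : Set
    q      : St F → Q
    q-surj : (a : Q) → ∃ λ s → q s ≡ a
    q-ker  : (s s' : St F) → (q s ≡ q s') ⇔ SameΣ lem F V Σs s s'
    RΣ     : Q → Q → Set
    Rmin⊆  : (a b : Q) →
             (Σ (St F) λ s → Σ (St F) λ t → q s ≡ a × q t ≡ b × Rel F s t) →
             RΣ a b
    ⊆Rmax  : (a b : Q) → RΣ a b →
             (s t : St F) → q s ≡ a → q t ≡ b →
             ∀ φ → (□ φ) ∈ Σs → T (eval lem F (□ φ) V s) → T (eval lem F φ V t)
    VΣ     : ℕ → Q → Bool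
    VΣ-ok  : ∀ i (s : St F) → var i ∈ Σs → VΣ i (q s) ≡ V i s

  frameΣ : Frame
  frameΣ = frame Q RΣ

AdmitsFiltration : LEM → (Fm → Set) → Set₁
AdmitsFiltration lem L =
  (F : Frame) → InFr lem L F →
  (V : ℕ → St F → Bool) (Σs : List Fm) → FLClosed Σs → All Basic Σs →
  Σ (Filtration lem F V Σs) λ fl → InFr lem L (Filtration.frameΣ fl)

{-# OPTIONS --safe #-}
module Submission where

-- Completeness.  Name every well-formed formula by a propositional variable.
-- The maximally L-consistent sets containing all basic formulas whose
-- translation is a theorem of μc-L form a generated subframe of the canonical
-- frame of L, so canonicity puts this subframe in Fr(L), although its points
-- decide all μc-formulas through their names.  Filtrate it through basic
-- formulas about the names of the Fischer-Ladner closure of φ.  Every set of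
-- states of the filtration is defined by a formula, so the least prefixpoint
-- rule can be applied to the actual value of a μ-formula; this needs that
-- membership implies truth for its body under such a nonstandard reading of
-- its variables, and there continuity helps: only ◇ is met above those
-- variables, and R^min suffices for ◇.  The rest of the truth lemma follows
-- from the prefixpoint axioms and R^max; ν is dual.

open import Defs
open import Data.Bool using (Bool; true; false; not; if_then_else_; T)
  renaming (_∨_ to _∨ᵇ_; _∧_ to _∧ᵇ_)
open import Data.Bool.Properties using (not-involutive; T-irrelevant; T?; T-∨; T-∧; ∨-∧-booleanAlgebra)
open import Algebra.Lattice.Properties.BooleanAlgebra ∨-∧-booleanAlgebra using (deMorgan₁; deMorgan₂)
open import Data.List using (List; []; _∷_; _++_; concatMap)
open import Data.List.Membership.Propositional using (_∈_; lose; find)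
open import Data.List.Membership.Propositional.Properties using (∈-++⁺ˡ; ∈-++⁺ʳ; ∈-concatMap⁺; ∈-concatMap⁻)
open import Data.List.Relation.Unary.All as All using (All; []; _∷_)
open import Data.List.Relation.Unary.All.Properties as All using (++⁺; ++⁻)
open import Data.List.Relation.Unary.Any using (here; there)
open import Data.Nat using (ℕ; zero; suc; _+_; _≤_; _⊔_; s≤s; _≤′_; ≤′-refl; ≤′-step)
open import Data.Nat.Properties
  using (+-suc; +-identityʳ; suc-injective; m⊔n≤o⇒m≤o; m⊔n≤o⇒n≤o; m≤m⊔n; m≤n⊔m; ≤-refl; ≤⇒≤′)
open import Data.Product as Prod using (Σ; _×_; _,_; ∃; proj₁; proj₂)
open import Data.Product.Function.NonDependent.Propositional using (_×-⇔_)
open import Data.Sum as Sum using (_⊎_; inj₁; inj₂; [_,_]′)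
open import Data.Sum.Function.Propositional using (_⊎-⇔_)
open import Data.Unit using (tt)
open import Function.Base using (_∘_; id; flip; _$_; case_of_)
open import Function.Bundles using (_⇔_; mk⇔; module Equivalence)
open import Function.Properties.Equivalence using () renaming (sym to ⇔-sym; trans to ⇔-trans; refl to ⇔-refl)
open import Relation.Binary.PropositionalEquality
  using (_≡_; refl; sym; trans; cong; cong₂; subst; subst₂)
open import Relation.Nullary using (Dec; yes; no; does; ¬_; contradiction)
open import Relation.Nullary.Decidable using (does-⇔; decidable-stable)

open Equivalence using (to; from)

-- Both hypotheses on `L` concern basic formulas: the canonical frame is built from them, and
-- filtrations are promised through sets of them. A canonical model made of maximal sets of fixpoint
-- formulas would give access to neither; hence the detour through names. The formula `γ` that
-- defines the value of a fixpoint is found only after the finite set has been fixed and the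
-- quotient taken. The body with `γ` put in therefore need not lie in that set, and R^max then says
-- nothing about it. A □ above the recursion variable would call for R^max at just this place, and a
-- ν for the extension of a formula in the set. Unfolding enlarges formulas, so the truth lemma
-- recurses on the original syntax tree and carries the unfolding in an environment; this also makes
-- the closure finite by construction.

private variable
  i : ℕ
  r r′ s : ℕ → ℕ
  X Y K K′ : ℕ → Bool
  a b φ ψ χ : Fm
  xs ys : List Fm
  σ τ δ : ℕ → Fm
  v : Fm → Bool

-- Renaming, substitution and negation

none : ℕ → Bool
none _ = false

infixr 5 _◂_

-- Contrast `liftS`: nothing is shifted, since all entries already live in the outer scope. On the
-- body of a fixpoint it substitutes `γ` for the bound variable and `σ` for the rest at once.
_◂_ : Fm → (ℕ → Fm) → ℕ → Fm
(γ ◂ σ) zero    = γ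
(γ ◂ σ) (suc i) = σ i

extB-cong : (∀ i → K i ≡ K′ i) → ∀ i → extB K i ≡ extB K′ i
extB-cong h zero    = refl
extB-cong h (suc i) = h i

extB-liftR : ∀ i → extB K (liftR r i) ≡ extB (K ∘ r) i
extB-liftR zero    = refl
extB-liftR (suc i) = refl

negK-cong : (∀ i → K i ≡ K′ i) → ∀ a → negK K a ≡ negK K′ a
negK-cong h (var i)  = cong (if_then var i else nvar i) (h i)
negK-cong h (nvar i) = cong (if_then nvar i else var i) (h i)
negK-cong h (a ∨ᶠ b) = cong₂ _∧ᶠ_ (negK-cong h a) (negK-cong h b)
negK-cong h (a ∧ᶠ b) = cong₂ _∨ᶠ_ (negK-cong h a) (negK-cong h b)
negK-cong h (◇ a)    = cong □_ (negK-cong h a)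
negK-cong h (□ a)    = cong ◇_ (negK-cong h a)
negK-cong h (μ a)    = cong ν_ (negK-cong (extB-cong h) a)
negK-cong h (ν a)    = cong μ_ (negK-cong (extB-cong h) a)

negK-involutive : ∀ K a → negK K (negK K a) ≡ a
negK-involutive K (var i) with K i in eq
... | true  rewrite eq = refl
... | false rewrite eq = refl
negK-involutive K (nvar i) with K i in eq
... | true  rewrite eq = refl
... | false rewrite eq = refl
negK-involutive K (a ∨ᶠ b) = cong₂ _∨ᶠ_ (negK-involutive K a) (negK-involutive K b)
negK-involutive K (a ∧ᶠ b) = cong₂ _∧ᶠ_ (negK-involutive K a) (negK-involutive K b)
negK-involutive K (◇ a)    = cong ◇_ (negK-involutive K a)
negK-involutive K (□ a)    = cong □_ (negK-involutive K a)
negK-involutive K (μ a)    = cong μ_ (negK-involutive (extB K) a)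
negK-involutive K (ν a)    = cong ν_ (negK-involutive (extB K) a)

~-involutive : ∀ a → ~ (~ a) ≡ a
~-involutive = negK-involutive none

negK-ren : ∀ K r a → negK K (ren r a) ≡ ren r (negK (K ∘ r) a)
negK-ren K r (var i) with K (r i)
... | true  = refl
... | false = refl
negK-ren K r (nvar i) with K (r i)
... | true  = refl
... | false = refl
negK-ren K r (a ∨ᶠ b) = cong₂ _∧ᶠ_ (negK-ren K r a) (negK-ren K r b)
negK-ren K r (a ∧ᶠ b) = cong₂ _∨ᶠ_ (negK-ren K r a) (negK-ren K r b)
negK-ren K r (◇ a)    = cong □_ (negK-ren K r a)
negK-ren K r (□ a)    = cong ◇_ (negK-ren K r a)
negK-ren K r (μ a)    = cong ν_ (trans (negK-ren (extB K) (liftR r) a)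
                                       (cong (ren (liftR r)) (negK-cong extB-liftR a)))
negK-ren K r (ν a)    = cong μ_ (trans (negK-ren (extB K) (liftR r) a)
                                       (cong (ren (liftR r)) (negK-cong extB-liftR a)))

-- Substituting below binders, σ sends the variables of K to variables of K′
-- and all others to formulas not mentioning K′, so no capture can occur.
record Respects (K K′ : ℕ → Bool) (σ : ℕ → Fm) : Set where
  field
    bound : ∀ i → K i ≡ true → ∃ λ j → σ i ≡ var j × K′ j ≡ true
    free  : ∀ i → K i ≡ false → negK K′ (σ i) ≡ ~ σ i

open Respects

liftS-respects : Respects K K′ σ → Respects (extB K) (extB K′) (liftS σ)
bound (liftS-respects R) zero    _ = zero , refl , refl
bound (liftS-respects R) (suc i) e with bound R i e
... | j , eq , t = suc j , cong (ren suc) eq , t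
free (liftS-respects {K′ = K′} {σ = σ} R) (suc i) e =
  trans (negK-ren (extB K′) suc (σ i))
        (trans (cong (ren suc) (free R i e)) (sym (negK-ren none suc (σ i))))

sub-negK : Respects K K′ σ → ∀ a → sub σ (negK K a) ≡ negK K′ (sub σ a)
sub-negK {K} R (var i) with K i in eq
... | false = sym (free R i eq)
... | true with bound R i eq
...   | j , σi , t rewrite σi | t = refl
sub-negK {K} {K′} {σ} R (nvar i) with K i in eq
... | false = trans (sym (negK-involutive K′ (σ i))) (cong (negK K′) (free R i eq))
... | true with bound R i eq
...   | j , σi , t rewrite σi | t = refl
sub-negK R (a ∨ᶠ b) = cong₂ _∧ᶠ_ (sub-negK R a) (sub-negK R b)
sub-negK R (a ∧ᶠ b) = cong₂ _∨ᶠ_ (sub-negK R a) (sub-negK R b)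
sub-negK R (◇ a)    = cong □_ (sub-negK R a)
sub-negK R (□ a)    = cong ◇_ (sub-negK R a)
sub-negK R (μ a)    = cong ν_ (sub-negK (liftS-respects R) a)
sub-negK R (ν a)    = cong μ_ (sub-negK (liftS-respects R) a)

sub-~ : ∀ σ a → sub σ (~ a) ≡ ~ sub σ a
sub-~ σ = sub-negK (record { bound = λ _ () ; free = λ _ _ → refl })

liftR-cong : (∀ i → r i ≡ r′ i) → ∀ i → liftR r i ≡ liftR r′ i
liftR-cong h zero    = refl
liftR-cong h (suc i) = cong suc (h i)

ren-cong : (∀ i → r i ≡ r′ i) → ∀ a → ren r a ≡ ren r′ a
ren-cong h (var i)  = cong var (h i)
ren-cong h (nvar i) = cong nvar (h i)
ren-cong h (a ∨ᶠ b) = cong₂ _∨ᶠ_ (ren-cong h a) (ren-cong h b)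
ren-cong h (a ∧ᶠ b) = cong₂ _∧ᶠ_ (ren-cong h a) (ren-cong h b)
ren-cong h (◇ a)    = cong ◇_ (ren-cong h a)
ren-cong h (□ a)    = cong □_ (ren-cong h a)
ren-cong h (μ a)    = cong μ_ (ren-cong (liftR-cong h) a)
ren-cong h (ν a)    = cong ν_ (ren-cong (liftR-cong h) a)

liftR-∘ : ∀ i → liftR r (liftR s i) ≡ liftR (r ∘ s) i
liftR-∘ zero    = refl
liftR-∘ (suc i) = refl

ren-ren : ∀ r s a → ren r (ren s a) ≡ ren (r ∘ s) a
ren-ren r s (var i)  = refl
ren-ren r s (nvar i) = refl
ren-ren r s (a ∨ᶠ b) = cong₂ _∨ᶠ_ (ren-ren r s a) (ren-ren r s b)
ren-ren r s (a ∧ᶠ b) = cong₂ _∧ᶠ_ (ren-ren r s a) (ren-ren r s b)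
ren-ren r s (◇ a)    = cong ◇_ (ren-ren r s a)
ren-ren r s (□ a)    = cong □_ (ren-ren r s a)
ren-ren r s (μ a)    = cong μ_ (trans (ren-ren (liftR r) (liftR s) a) (ren-cong liftR-∘ a))
ren-ren r s (ν a)    = cong ν_ (trans (ren-ren (liftR r) (liftR s) a) (ren-cong liftR-∘ a))

liftS-cong : (∀ i → Occ (suc i) a → σ i ≡ τ i) → ∀ i → Occ i a → liftS σ i ≡ liftS τ i
liftS-cong h zero    _ = refl
liftS-cong h (suc i) o = cong (ren suc) (h i o)

-- Stated for occurring variables, because the two environments of `Con-lower` agree only off `X`,
-- and an `X`-free formula sees no more.
sub-cong-Occ : ∀ a → (∀ i → Occ i a → σ i ≡ τ i) → sub σ a ≡ sub τ a
sub-cong-Occ (var i)  h = h i ovar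
sub-cong-Occ (nvar i) h = cong ~_ (h i onvar)
sub-cong-Occ (a ∨ᶠ b) h = cong₂ _∨ᶠ_ (sub-cong-Occ a λ i → h i ∘ oorl) (sub-cong-Occ b λ i → h i ∘ oorr)
sub-cong-Occ (a ∧ᶠ b) h = cong₂ _∧ᶠ_ (sub-cong-Occ a λ i → h i ∘ oandl) (sub-cong-Occ b λ i → h i ∘ oandr)
sub-cong-Occ (◇ a)    h = cong ◇_ (sub-cong-Occ a λ i → h i ∘ odia)
sub-cong-Occ (□ a)    h = cong □_ (sub-cong-Occ a λ i → h i ∘ obox)
sub-cong-Occ (μ a)    h = cong μ_ (sub-cong-Occ a (liftS-cong λ i → h i ∘ omu))
sub-cong-Occ (ν a)    h = cong ν_ (sub-cong-Occ a (liftS-cong λ i → h i ∘ onu))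

sub-cong : (∀ i → σ i ≡ τ i) → ∀ a → sub σ a ≡ sub τ a
sub-cong h a = sub-cong-Occ a λ i _ → h i

ren-liftS : ∀ r σ i → ren (liftR r) (liftS σ i) ≡ liftS (ren r ∘ σ) i
ren-liftS r σ zero    = refl
ren-liftS r σ (suc i) = trans (ren-ren (liftR r) suc (σ i)) (sym (ren-ren suc r (σ i)))

ren-sub : ∀ r σ a → ren r (sub σ a) ≡ sub (ren r ∘ σ) a
ren-sub r σ (var i)  = refl
ren-sub r σ (nvar i) = sym (negK-ren none r (σ i))
ren-sub r σ (a ∨ᶠ b) = cong₂ _∨ᶠ_ (ren-sub r σ a) (ren-sub r σ b)
ren-sub r σ (a ∧ᶠ b) = cong₂ _∧ᶠ_ (ren-sub r σ a) (ren-sub r σ b)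
ren-sub r σ (◇ a)    = cong ◇_ (ren-sub r σ a)
ren-sub r σ (□ a)    = cong □_ (ren-sub r σ a)
ren-sub r σ (μ a)    = cong μ_ (trans (ren-sub (liftR r) (liftS σ) a) (sub-cong (ren-liftS r σ) a))
ren-sub r σ (ν a)    = cong ν_ (trans (ren-sub (liftR r) (liftS σ) a) (sub-cong (ren-liftS r σ) a))

liftS-liftR : ∀ i → liftS σ (liftR r i) ≡ liftS (σ ∘ r) i
liftS-liftR zero    = refl
liftS-liftR (suc i) = refl

sub-ren : ∀ σ r a → sub σ (ren r a) ≡ sub (σ ∘ r) a
sub-ren σ r (var i)  = refl
sub-ren σ r (nvar i) = refl
sub-ren σ r (a ∨ᶠ b) = cong₂ _∨ᶠ_ (sub-ren σ r a) (sub-ren σ r b)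
sub-ren σ r (a ∧ᶠ b) = cong₂ _∧ᶠ_ (sub-ren σ r a) (sub-ren σ r b)
sub-ren σ r (◇ a)    = cong ◇_ (sub-ren σ r a)
sub-ren σ r (□ a)    = cong □_ (sub-ren σ r a)
sub-ren σ r (μ a)    = cong μ_ (trans (sub-ren (liftS σ) (liftR r) a) (sub-cong liftS-liftR a))
sub-ren σ r (ν a)    = cong ν_ (trans (sub-ren (liftS σ) (liftR r) a) (sub-cong liftS-liftR a))

sub-liftS : ∀ σ τ i → sub (liftS σ) (liftS τ i) ≡ liftS (sub σ ∘ τ) i
sub-liftS σ τ zero    = refl
sub-liftS σ τ (suc i) = trans (sub-ren (liftS σ) suc (τ i)) (sym (ren-sub suc σ (τ i)))

sub-sub : ∀ σ τ a → sub σ (sub τ a) ≡ sub (sub σ ∘ τ) a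
sub-sub σ τ (var i)  = refl
sub-sub σ τ (nvar i) = sub-~ σ (τ i)
sub-sub σ τ (a ∨ᶠ b) = cong₂ _∨ᶠ_ (sub-sub σ τ a) (sub-sub σ τ b)
sub-sub σ τ (a ∧ᶠ b) = cong₂ _∧ᶠ_ (sub-sub σ τ a) (sub-sub σ τ b)
sub-sub σ τ (◇ a)    = cong ◇_ (sub-sub σ τ a)
sub-sub σ τ (□ a)    = cong □_ (sub-sub σ τ a)
sub-sub σ τ (μ a)    = cong μ_ (trans (sub-sub (liftS σ) (liftS τ) a) (sub-cong (sub-liftS σ τ) a))
sub-sub σ τ (ν a)    = cong ν_ (trans (sub-sub (liftS σ) (liftS τ) a) (sub-cong (sub-liftS σ τ) a))

liftS-var : ∀ i → liftS var i ≡ var i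
liftS-var zero    = refl
liftS-var (suc i) = refl

sub-var : ∀ a → sub var a ≡ a
sub-var (var i)  = refl
sub-var (nvar i) = refl
sub-var (a ∨ᶠ b) = cong₂ _∨ᶠ_ (sub-var a) (sub-var b)
sub-var (a ∧ᶠ b) = cong₂ _∧ᶠ_ (sub-var a) (sub-var b)
sub-var (◇ a)    = cong ◇_ (sub-var a)
sub-var (□ a)    = cong □_ (sub-var a)
sub-var (μ a)    = cong μ_ (trans (sub-cong liftS-var a) (sub-var a))
sub-var (ν a)    = cong ν_ (trans (sub-cong liftS-var a) (sub-var a))

-- The axioms and rules unfold the already substituted body, whereas the truth lemma extends an
-- environment; this equation passes between the two.
sub-liftS-sub0 : ∀ τ γ a → sub (liftS τ) a [ γ /0] ≡ sub (γ ◂ τ) a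
sub-liftS-sub0 τ γ a = trans (sub-sub (sub0 γ) (liftS τ) a) (sub-cong pointwise a)
  where
  pointwise : ∀ i → sub (sub0 γ) (liftS τ i) ≡ (γ ◂ τ) i
  pointwise zero    = refl
  pointwise (suc i) = trans (sub-ren (sub0 γ) suc (τ i)) (sub-var (τ i))

-- Well-formedness and continuity

Occ-ren : ∀ a {j} → Occ j (ren r a) → ∃ λ i → r i ≡ j × Occ i a
Occ-ren (var i)  ovar  = i , refl , ovar
Occ-ren (nvar i) onvar = i , refl , onvar
Occ-ren (a ∨ᶠ b) (oorl o)  with i , e , p ← Occ-ren a o = i , e , oorl p
Occ-ren (a ∨ᶠ b) (oorr o)  with i , e , p ← Occ-ren b o = i , e , oorr p
Occ-ren (a ∧ᶠ b) (oandl o) with i , e , p ← Occ-ren a o = i , e , oandl p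
Occ-ren (a ∧ᶠ b) (oandr o) with i , e , p ← Occ-ren b o = i , e , oandr p
Occ-ren (◇ a)    (odia o)  with i , e , p ← Occ-ren a o = i , e , odia p
Occ-ren (□ a)    (obox o)  with i , e , p ← Occ-ren a o = i , e , obox p
Occ-ren (μ a)    (omu o)   with suc i , refl , p ← Occ-ren a o = i , refl , omu p
Occ-ren (ν a)    (onu o)   with suc i , refl , p ← Occ-ren a o = i , refl , onu p

Occ-negK : ∀ K a → Occ i (negK K a) → Occ i a
Occ-negK K (var j) o with K j | o
... | true  | ovar  = ovar
... | false | onvar = ovar
Occ-negK K (nvar j) o with K j | o
... | true  | onvar = onvar
... | false | ovar  = onvar
Occ-negK K (a ∨ᶠ b) (oandl o) = oorl (Occ-negK K a o)
Occ-negK K (a ∨ᶠ b) (oandr o) = oorr (Occ-negK K b o)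
Occ-negK K (a ∧ᶠ b) (oorl o)  = oandl (Occ-negK K a o)
Occ-negK K (a ∧ᶠ b) (oorr o)  = oandr (Occ-negK K b o)
Occ-negK K (◇ a)    (obox o)  = odia (Occ-negK K a o)
Occ-negK K (□ a)    (odia o)  = obox (Occ-negK K a o)
Occ-negK K (μ a)    (onu o)   = omu (Occ-negK (extB K) a o)
Occ-negK K (ν a)    (omu o)   = onu (Occ-negK (extB K) a o)

mutual
  Occ-sub : ∀ a {j} → Occ j (sub σ a) → ∃ λ i → Occ i a × Occ j (σ i)
  Occ-sub (var i)  o = i , ovar , o
  Occ-sub (nvar i) o = i , onvar , Occ-negK none _ o
  Occ-sub (a ∨ᶠ b) (oorl o)  with i , p , q ← Occ-sub a o = i , oorl p , q
  Occ-sub (a ∨ᶠ b) (oorr o)  with i , p , q ← Occ-sub b o = i , oorr p , q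
  Occ-sub (a ∧ᶠ b) (oandl o) with i , p , q ← Occ-sub a o = i , oandl p , q
  Occ-sub (a ∧ᶠ b) (oandr o) with i , p , q ← Occ-sub b o = i , oandr p , q
  Occ-sub (◇ a)    (odia o)  with i , p , q ← Occ-sub a o = i , odia p , q
  Occ-sub (□ a)    (obox o)  with i , p , q ← Occ-sub a o = i , obox p , q
  Occ-sub (μ a)    (omu o)   with i , p , q ← Occ-sub-liftS a o = i , omu p , q
  Occ-sub (ν a)    (onu o)   with i , p , q ← Occ-sub-liftS a o = i , onu p , q

  Occ-sub-liftS : ∀ a {j} → Occ (suc j) (sub (liftS σ) a) → ∃ λ i → Occ (suc i) a × Occ j (σ i)
  Occ-sub-liftS {σ} a o with Occ-sub a o
  -- Index zero is excluded: `liftS σ zero` is `var zero`, where no successor index occurs.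
  ... | suc i , p , q with _ , refl , q′ ← Occ-ren (σ i) q = i , p , q′

_⊆ᵇ_ : (ℕ → Bool) → (ℕ → Bool) → Set
X ⊆ᵇ Y = ∀ i → X i ≡ true → Y i ≡ true

⊆ᵇ-false : X ⊆ᵇ Y → ∀ i → Y i ≡ false → X i ≡ false
⊆ᵇ-false {X} h i e with X i in eq
... | false = refl
... | true  = trans (sym (h i eq)) e

extB-⊆ᵇ : X ⊆ᵇ Y → extB X ⊆ᵇ extB Y
extB-⊆ᵇ h zero    e = e
extB-⊆ᵇ h (suc i) e = h i e

only0⊆extB : only0 ⊆ᵇ extB X
only0⊆extB zero _ = refl

Con-var : ∀ i → Con X (var i)
Con-var {X} i with X i in eq
... | true  = cvar eq
... | false = cfree wvar λ { _ ovar → eq }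

Cocon-var : ∀ i → Cocon X (var i)
Cocon-var {X} i with X i in eq
... | true  = kvar eq
... | false = kfree wvar λ { _ ovar → eq }

-- A variable dropped from the set turns into a free formula, hence `Con-var`. This makes a body
-- continuous in an enlarged set continuous in its own bound variable, so an inner fixpoint is well
-- formed by itself.
Con-⊆ᵇ : X ⊆ᵇ Y → Con Y a → Con X a
Con-⊆ᵇ h (cvar _)    = Con-var _
Con-⊆ᵇ h (cfree w f) = cfree w λ i → ⊆ᵇ-false h i ∘ f i
Con-⊆ᵇ h (cor c d)   = cor (Con-⊆ᵇ h c) (Con-⊆ᵇ h d)
Con-⊆ᵇ h (cand c d)  = cand (Con-⊆ᵇ h c) (Con-⊆ᵇ h d)
Con-⊆ᵇ h (cdia c)    = cdia (Con-⊆ᵇ h c)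
Con-⊆ᵇ h (cmu c)     = cmu (Con-⊆ᵇ (extB-⊆ᵇ h) c)

Cocon-⊆ᵇ : X ⊆ᵇ Y → Cocon Y a → Cocon X a
Cocon-⊆ᵇ h (kvar _)    = Cocon-var _
Cocon-⊆ᵇ h (kfree w f) = kfree w λ i → ⊆ᵇ-false h i ∘ f i
Cocon-⊆ᵇ h (kor c d)   = kor (Cocon-⊆ᵇ h c) (Cocon-⊆ᵇ h d)
Cocon-⊆ᵇ h (kand c d)  = kand (Cocon-⊆ᵇ h c) (Cocon-⊆ᵇ h d)
Cocon-⊆ᵇ h (kbox c)    = kbox (Cocon-⊆ᵇ h c)
Cocon-⊆ᵇ h (knu c)     = knu (Cocon-⊆ᵇ (extB-⊆ᵇ h) c)

Con⇒WF : Con X a → WF a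
Con⇒WF (cvar _)    = wvar
Con⇒WF (cfree w _) = w
Con⇒WF (cor c d)   = wor (Con⇒WF c) (Con⇒WF d)
Con⇒WF (cand c d)  = wand (Con⇒WF c) (Con⇒WF d)
Con⇒WF (cdia c)    = wdia (Con⇒WF c)
Con⇒WF (cmu c)     = wmu (Con-⊆ᵇ only0⊆extB c)

Cocon⇒WF : Cocon X a → WF a
Cocon⇒WF (kvar _)    = wvar
Cocon⇒WF (kfree w _) = w
Cocon⇒WF (kor c d)   = wor (Cocon⇒WF c) (Cocon⇒WF d)
Cocon⇒WF (kand c d)  = wand (Cocon⇒WF c) (Cocon⇒WF d)
Cocon⇒WF (kbox c)    = wbox (Cocon⇒WF c)
Cocon⇒WF (knu c)     = wnu (Cocon-⊆ᵇ only0⊆extB c)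

mutual
  WF-negK : WF a → WF (negK K a)
  WF-negK {K = K} (wvar {i}) with K i
  ... | true  = wvar
  ... | false = wnvar
  WF-negK {K = K} (wnvar {i}) with K i
  ... | true  = wnvar
  ... | false = wvar
  WF-negK (wor u v)  = wand (WF-negK u) (WF-negK v)
  WF-negK (wand u v) = wor (WF-negK u) (WF-negK v)
  WF-negK (wdia u)   = wbox (WF-negK u)
  WF-negK (wbox u)   = wdia (WF-negK u)
  WF-negK (wmu c)    = wnu (Con-negK only0⊆extB c)
  WF-negK (wnu c)    = wmu (Cocon-negK only0⊆extB c)

  -- Negation has to keep the recursion variables, which `Cocon` admits only positively; `X ⊆ᵇ K`
  -- ensures it.
  Con-negK : X ⊆ᵇ K → Con X a → Cocon X (negK K a)
  Con-negK h (cvar {i} e) rewrite h i e = kvar e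
  Con-negK h (cfree w f)  = kfree (WF-negK w) λ i → f i ∘ Occ-negK _ _
  Con-negK h (cor c d)    = kand (Con-negK h c) (Con-negK h d)
  Con-negK h (cand c d)   = kor (Con-negK h c) (Con-negK h d)
  Con-negK h (cdia c)     = kbox (Con-negK h c)
  Con-negK h (cmu c)      = knu (Con-negK (extB-⊆ᵇ h) c)

  Cocon-negK : X ⊆ᵇ K → Cocon X a → Con X (negK K a)
  Cocon-negK h (kvar {i} e) rewrite h i e = cvar e
  Cocon-negK h (kfree w f)  = cfree (WF-negK w) λ i → f i ∘ Occ-negK _ _
  Cocon-negK h (kor c d)    = cand (Cocon-negK h c) (Cocon-negK h d)
  Cocon-negK h (kand c d)   = cor (Cocon-negK h c) (Cocon-negK h d)
  Cocon-negK h (kbox c)     = cdia (Cocon-negK h c)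
  Cocon-negK h (knu c)      = cmu (Cocon-negK (extB-⊆ᵇ h) c)

extB-ren : (∀ i → X i ≡ Y (r i)) → ∀ i → extB X i ≡ extB Y (liftR r i)
extB-ren h zero    = refl
extB-ren h (suc i) = h i

Free-ren : (∀ i → X i ≡ Y (r i)) → Free X a → Free Y (ren r a)
Free-ren {a = a} h f j o with i , refl , p ← Occ-ren a o = trans (sym (h i)) (f i p)

mutual
  WF-ren : WF a → WF (ren r a)
  WF-ren wvar       = wvar
  WF-ren wnvar      = wnvar
  WF-ren (wor u v)  = wor (WF-ren u) (WF-ren v)
  WF-ren (wand u v) = wand (WF-ren u) (WF-ren v)
  WF-ren (wdia u)   = wdia (WF-ren u)
  WF-ren (wbox u)   = wbox (WF-ren u)
  WF-ren (wmu c)    = wmu (Con-ren (extB-ren λ _ → refl) c)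
  WF-ren (wnu c)    = wnu (Cocon-ren (extB-ren λ _ → refl) c)

  Con-ren : (∀ i → X i ≡ Y (r i)) → Con X a → Con Y (ren r a)
  Con-ren h (cvar {i} e) = cvar (trans (sym (h i)) e)
  Con-ren h (cfree w f)  = cfree (WF-ren w) (Free-ren h f)
  Con-ren h (cor c d)    = cor (Con-ren h c) (Con-ren h d)
  Con-ren h (cand c d)   = cand (Con-ren h c) (Con-ren h d)
  Con-ren h (cdia c)     = cdia (Con-ren h c)
  Con-ren h (cmu c)      = cmu (Con-ren (extB-ren h) c)

  Cocon-ren : (∀ i → X i ≡ Y (r i)) → Cocon X a → Cocon Y (ren r a)
  Cocon-ren h (kvar {i} e) = kvar (trans (sym (h i)) e)
  Cocon-ren h (kfree w f)  = kfree (WF-ren w) (Free-ren h f)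
  Cocon-ren h (kor c d)    = kor (Cocon-ren h c) (Cocon-ren h d)
  Cocon-ren h (kand c d)   = kand (Cocon-ren h c) (Cocon-ren h d)
  Cocon-ren h (kbox c)     = kbox (Cocon-ren h c)
  Cocon-ren h (knu c)      = knu (Cocon-ren (extB-ren h) c)

-- The counterpart of `Respects` for continuity. Recursion variables are only renamed, which is all
-- that substitution below a binder asks for.
record Maps (X Y : ℕ → Bool) (σ : ℕ → Fm) : Set where
  field
    inside  : ∀ i → X i ≡ true → ∃ λ j → σ i ≡ var j × Y j ≡ true
    outside : ∀ i → X i ≡ false → Free Y (σ i)

open Maps

Maps-liftS : Maps X Y σ → Maps (extB X) (extB Y) (liftS σ)
inside (Maps-liftS m) zero    _ = zero , refl , refl
inside (Maps-liftS m) (suc i) e with j , eq , t ← inside m i e = suc j , cong (ren suc) eq , t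
outside (Maps-liftS m) (suc i) e = Free-ren (λ _ → refl) (outside m i e)

Free-sub : Maps X Y σ → Free X a → Free Y (sub σ a)
Free-sub {a = a} m f j o with i , p , q ← Occ-sub a o = outside m i (f i p) j q

WF-liftS : (∀ i → WF (σ i)) → ∀ i → WF (liftS σ i)
WF-liftS w zero    = wvar
WF-liftS w (suc i) = WF-ren (w i)

Maps-none : ∀ σ → Maps none none σ
Maps-none σ = record { inside = λ _ () ; outside = λ _ _ _ _ → refl }

mutual
  WF-sub : (∀ i → WF (σ i)) → WF a → WF (sub σ a)
  WF-sub w (wvar {i})  = w i
  WF-sub w (wnvar {i}) = WF-negK (w i)
  WF-sub w (wor u v)   = wor (WF-sub w u) (WF-sub w v)
  WF-sub w (wand u v)  = wand (WF-sub w u) (WF-sub w v)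
  WF-sub w (wdia u)    = wdia (WF-sub w u)
  WF-sub w (wbox u)    = wbox (WF-sub w u)
  WF-sub w (wmu c)     = wmu (Con-sub (WF-liftS w) (Maps-liftS (Maps-none _)) c)
  WF-sub w (wnu c)     = wnu (Cocon-sub (WF-liftS w) (Maps-liftS (Maps-none _)) c)

  Con-sub : (∀ i → WF (σ i)) → Maps X Y σ → Con X a → Con Y (sub σ a)
  Con-sub w m (cvar {i} e) with j , eq , t ← inside m i e = subst (Con _) (sym eq) (cvar t)
  Con-sub w m (cfree u f)  = cfree (WF-sub w u) (Free-sub m f)
  Con-sub w m (cor c d)    = cor (Con-sub w m c) (Con-sub w m d)
  Con-sub w m (cand c d)   = cand (Con-sub w m c) (Con-sub w m d)
  Con-sub w m (cdia c)     = cdia (Con-sub w m c)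
  Con-sub w m (cmu c)      = cmu (Con-sub (WF-liftS w) (Maps-liftS m) c)

  Cocon-sub : (∀ i → WF (σ i)) → Maps X Y σ → Cocon X a → Cocon Y (sub σ a)
  Cocon-sub w m (kvar {i} e) with j , eq , t ← inside m i e = subst (Cocon _) (sym eq) (kvar t)
  Cocon-sub w m (kfree u f)  = kfree (WF-sub w u) (Free-sub m f)
  Cocon-sub w m (kor c d)    = kor (Cocon-sub w m c) (Cocon-sub w m d)
  Cocon-sub w m (kand c d)   = kand (Cocon-sub w m c) (Cocon-sub w m d)
  Cocon-sub w m (kbox c)     = kbox (Cocon-sub w m c)
  Cocon-sub w m (knu c)      = knu (Cocon-sub (WF-liftS w) (Maps-liftS m) c)

Con-sub-liftS : (∀ i → WF (σ i)) → Con only0 a → Con only0 (sub (liftS σ) a)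
Con-sub-liftS w = Con-sub (WF-liftS w) (Maps-liftS (Maps-none _))

Cocon-sub-liftS : (∀ i → WF (σ i)) → Cocon only0 a → Cocon only0 (sub (liftS σ) a)
Cocon-sub-liftS w = Cocon-sub (WF-liftS w) (Maps-liftS (Maps-none _))

-- Semantics

T-does : {A : Set} (a? : Dec A) → T (does a?) ⇔ A
T-does (yes a) = mk⇔ (λ _ → a) _
T-does (no ¬a) = mk⇔ (λ ()) ¬a

T-not : ∀ {x} → T (not x) ⇔ (¬ T x)
T-not {true}  = mk⇔ (λ ()) (λ ¬t → ¬t tt)
T-not {false} = mk⇔ (λ _ ()) _

T-⇒ᵇ : ∀ {x y} → T (not x ∨ᵇ y) ⇔ (T x → T y)
T-⇒ᵇ {true}  = mk⇔ (λ y _ → y) (λ f → f tt)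
T-⇒ᵇ {false} = mk⇔ (λ _ ()) _

T⇔⇒≡ : ∀ {x y} → T x ⇔ T y → x ≡ y
T⇔⇒≡ {true}  {true}  e = refl
T⇔⇒≡ {true}  {false} e with () ← to e tt
T⇔⇒≡ {false} {true}  e with () ← from e tt
T⇔⇒≡ {false} {false} e = refl

module Semantics (lem : LEM) (F : Frame) where

  private
    S = St F
    variable
      f g : S → Bool
      Φ Ψ : (S → Bool) → S → Bool
      ρ ρ′ : ℕ → S → Bool

  _⊆_ : (S → Bool) → (S → Bool) → Set
  f ⊆ g = ∀ s → T (f s) → T (g s)

  -- The clauses of `eval` as operators on predicates, equal to them by computation, so that facts
  -- about the operators apply to formulas as they stand.
  dia box : (S → Bool) → S → Bool
  dia f s = does (lem (Σ S λ t → Rel F s t × T (f t)))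
  box f s = does (lem ((t : S) → Rel F s t → T (f t)))

  mu nu : ((S → Bool) → S → Bool) → S → Bool
  mu Φ s = does (lem ((X : S → Bool) → ((t : S) → T (Φ X t) → T (X t)) → T (X s)))
  nu Φ s = does (lem (Σ (S → Bool) λ X → ((t : S) → T (X t) → T (Φ X t)) × T (X s)))

  dia-mono : f ⊆ g → dia f ⊆ dia g
  dia-mono h s = from (T-does (lem _)) ∘ Prod.map₂ (Prod.map₂ (h _)) ∘ to (T-does (lem _))

  box-mono : f ⊆ g → box f ⊆ box g
  box-mono h s d = from (T-does (lem _)) λ t → h t ∘ to (T-does (lem _)) d t

  -- Every prefixpoint of `Ψ` is one of `Φ`, so the intersection defining `mu Φ` runs over more
  -- sets.
  mu-mono : (∀ X → Φ X ⊆ Ψ X) → mu Φ ⊆ mu Ψ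
  mu-mono h s d = from (T-does (lem _)) λ X pre → to (T-does (lem _)) d X λ t → pre t ∘ h X t

  nu-mono : (∀ X → Φ X ⊆ Ψ X) → nu Φ ⊆ nu Ψ
  nu-mono h s = from (T-does (lem _)) ∘ Prod.map₂ (λ {X} → Prod.map₁ λ post t → h X t ∘ post t)
              ∘ to (T-does (lem _))

  ≗⇒⊆ : (∀ s → f s ≡ g s) → f ⊆ g
  ≗⇒⊆ h s = subst T (h s)

  ≗-antisym : f ⊆ g → g ⊆ f → ∀ s → f s ≡ g s
  ≗-antisym h k s = T⇔⇒≡ (mk⇔ (h s) (k s))

  -- Predicates are compared pointwise, since `≡` between functions would call for extensionality.
  dia-cong : (∀ s → f s ≡ g s) → ∀ s → dia f s ≡ dia g s
  dia-cong h = ≗-antisym (dia-mono (≗⇒⊆ h)) (dia-mono (≗⇒⊆ (sym ∘ h)))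

  box-cong : (∀ s → f s ≡ g s) → ∀ s → box f s ≡ box g s
  box-cong h = ≗-antisym (box-mono (≗⇒⊆ h)) (box-mono (≗⇒⊆ (sym ∘ h)))

  mu-cong : (∀ X s → Φ X s ≡ Ψ X s) → ∀ s → mu Φ s ≡ mu Ψ s
  mu-cong h = ≗-antisym (mu-mono (≗⇒⊆ ∘ h)) (mu-mono λ X → ≗⇒⊆ (sym ∘ h X))

  nu-cong : (∀ X s → Φ X s ≡ Ψ X s) → ∀ s → nu Φ s ≡ nu Ψ s
  nu-cong h = ≗-antisym (nu-mono (≗⇒⊆ ∘ h)) (nu-mono λ X → ≗⇒⊆ (sym ∘ h X))

  Complementary : (S → Bool) → (S → Bool) → Set
  Complementary f g = ∀ s → f s ≡ not (g s)

  Complementary-sym : Complementary f g → Complementary g f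
  Complementary-sym h s = sym (trans (cong not (h s)) (not-involutive _))

  complement : (S → Bool) → S → Bool
  complement f s = not (f s)

  box-dia : Complementary f g → Complementary (box f) (dia g)
  box-dia h s = T⇔⇒≡ $ mk⇔
    (λ d → from T-not λ e → case to (T-does (lem _)) e of λ
       (t , rst , gt) → to T-not (subst T (h t) (to (T-does (lem _)) d t rst)) gt)
    (λ n → from (T-does (lem _)) λ t rst → subst T (sym (h t)) $ from T-not λ gt →
       to T-not n (from (T-does (lem _)) (t , rst , gt)))

  -- The complement of a postfixpoint of `Φ` is a prefixpoint of `Ψ`, and conversely.
  nu-mu : (∀ {X Y} → Complementary X Y → Complementary (Φ X) (Ψ Y)) →
          Complementary (nu Φ) (mu Ψ)
  nu-mu {Φ} {Ψ} h s = T⇔⇒≡ $ mk⇔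
    (λ d → from T-not λ e → case to (T-does (lem _)) d of λ
       (X , post , Xs) → to T-not (to (T-does (lem _)) e (complement X) λ t Ψt →
           from T-not λ Xt → to T-not (subst T (h (λ s → sym (not-involutive (X s))) t) (post t Xt)) Ψt)
         Xs)
    (λ n → decidable-stable (T? _) λ ¬nu → to T-not n $ from (T-does (lem _)) λ Y pre →
       decidable-stable (T? _) λ ¬Ys → ¬nu $ from (T-does (lem _)) $
         complement Y ,
         (λ t nYt → subst T (sym (h (λ _ → refl) t)) $ from T-not (to T-not nYt ∘ pre t)) ,
         from T-not ¬Ys)

  ⟦_⟧ : Fm → (ℕ → S → Bool) → S → Bool
  ⟦_⟧ = eval lem F

  private
    Negates : (ℕ → Bool) → (ρ ρ′ : ℕ → S → Bool) → Set
    Negates K ρ ρ′ = ∀ i s → ρ′ i s ≡ (if K i then not (ρ i s) else ρ i s)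

    Negates-∷ : ∀ {X Y} → Negates K ρ ρ′ → Complementary Y X →
                Negates (extB K) (X ∷ₑ ρ) (Y ∷ₑ ρ′)
    Negates-∷ h c zero    = c
    Negates-∷ h c (suc i) = h i

  -- `negK` keeps the literals of `K`, so their values are complemented in the environment instead;
  -- this invariant survives a binder.
  eval-negK : ∀ a → Negates K ρ ρ′ → Complementary (⟦ negK K a ⟧ ρ) (⟦ a ⟧ ρ′)
  eval-negK {K} (var i) h s with K i | h i s
  ... | true  | e = sym (trans (cong not e) (not-involutive _))
  ... | false | e = cong not (sym e)
  eval-negK {K} (nvar i) h s with K i | h i s
  ... | true  | e = trans (sym e) (sym (not-involutive _))
  ... | false | e = trans (sym e) (sym (not-involutive _))
  eval-negK (a ∨ᶠ b) h s = trans (cong₂ _∧ᵇ_ (eval-negK a h s) (eval-negK b h s)) (sym (deMorgan₂ (⟦ a ⟧ _ s) _))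
  eval-negK (a ∧ᶠ b) h s = trans (cong₂ _∨ᵇ_ (eval-negK a h s) (eval-negK b h s)) (sym (deMorgan₁ (⟦ a ⟧ _ s) _))
  eval-negK (◇ a) h = box-dia (eval-negK a h)
  eval-negK (□ a) h = Complementary-sym (box-dia (Complementary-sym (eval-negK a h)))
  eval-negK (μ a) h = nu-mu λ c → eval-negK a (Negates-∷ h (Complementary-sym c))
  eval-negK (ν a) h = Complementary-sym (nu-mu λ c → Complementary-sym (eval-negK a (Negates-∷ h c)))

  eval-~ : ∀ a → Complementary (⟦ ~ a ⟧ ρ) (⟦ a ⟧ ρ)
  eval-~ a = eval-negK a λ _ _ → refl

  eval-⇒ : ∀ a b {s} → T (⟦ a ⇒ b ⟧ ρ s) ⇔ (T (⟦ a ⟧ ρ s) → T (⟦ b ⟧ ρ s))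
  eval-⇒ {ρ} a b {s} rewrite eval-~ {ρ = ρ} a s = T-⇒ᵇ

  eval-ren : ∀ a → (∀ i s → ρ′ i s ≡ ρ (r i) s) → ∀ s → ⟦ ren r a ⟧ ρ s ≡ ⟦ a ⟧ ρ′ s
  eval-ren (var i)  h s = sym (h i s)
  eval-ren (nvar i) h s = cong not (sym (h i s))
  eval-ren (a ∨ᶠ b) h s = cong₂ _∨ᵇ_ (eval-ren a h s) (eval-ren b h s)
  eval-ren (a ∧ᶠ b) h s = cong₂ _∧ᵇ_ (eval-ren a h s) (eval-ren b h s)
  eval-ren (◇ a)    h   = dia-cong (eval-ren a h)
  eval-ren (□ a)    h   = box-cong (eval-ren a h)
  eval-ren (μ a)    h   = mu-cong λ X → eval-ren a λ { zero _ → refl ; (suc i) → h i }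
  eval-ren (ν a)    h   = nu-cong λ X → eval-ren a λ { zero _ → refl ; (suc i) → h i }

  private
    liftS-eval : ∀ {X} → (∀ i s → ρ′ i s ≡ ⟦ σ i ⟧ ρ s) →
                 ∀ i s → (X ∷ₑ ρ′) i s ≡ ⟦ liftS σ i ⟧ (X ∷ₑ ρ) s
    liftS-eval h zero    s = refl
    liftS-eval {σ = σ} h (suc i) s = trans (h i s) (sym (eval-ren (σ i) (λ _ _ → refl) s))

  eval-sub : ∀ a → (∀ i s → ρ′ i s ≡ ⟦ σ i ⟧ ρ s) → ∀ s → ⟦ sub σ a ⟧ ρ s ≡ ⟦ a ⟧ ρ′ s
  eval-sub (var i)  h s = sym (h i s)
  eval-sub {σ = σ} (nvar i) h s = trans (eval-~ (σ i) s) (cong not (sym (h i s)))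
  eval-sub (a ∨ᶠ b) h s = cong₂ _∨ᵇ_ (eval-sub a h s) (eval-sub b h s)
  eval-sub (a ∧ᶠ b) h s = cong₂ _∧ᵇ_ (eval-sub a h s) (eval-sub b h s)
  eval-sub (◇ a)    h   = dia-cong (eval-sub a h)
  eval-sub (□ a)    h   = box-cong (eval-sub a h)
  eval-sub (μ a)    h   = mu-cong λ X → eval-sub a (liftS-eval h)
  eval-sub (ν a)    h   = nu-cong λ X → eval-sub a (liftS-eval h)

  eval-[/0] : ∀ a γ s → ⟦ a [ γ /0] ⟧ ρ s ≡ ⟦ a ⟧ (⟦ γ ⟧ ρ ∷ₑ ρ) s
  eval-[/0] a γ = eval-sub a λ { zero _ → refl ; (suc i) _ → refl }

  private
    ∷-cong-Occ : ∀ {X} → (∀ i → Occ (suc i) a → ∀ s → ρ i s ≡ ρ′ i s) →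
                 ∀ i → Occ i a → ∀ s → (X ∷ₑ ρ) i s ≡ (X ∷ₑ ρ′) i s
    ∷-cong-Occ h zero    _ _ = refl
    ∷-cong-Occ h (suc i) o   = h i o

  eval-cong-Occ : ∀ a → (∀ i → Occ i a → ∀ s → ρ i s ≡ ρ′ i s) → ∀ s → ⟦ a ⟧ ρ s ≡ ⟦ a ⟧ ρ′ s
  eval-cong-Occ (var i)  h s = h i ovar s
  eval-cong-Occ (nvar i) h s = cong not (h i onvar s)
  eval-cong-Occ (a ∨ᶠ b) h s = cong₂ _∨ᵇ_ (eval-cong-Occ a (λ i → h i ∘ oorl) s) (eval-cong-Occ b (λ i → h i ∘ oorr) s)
  eval-cong-Occ (a ∧ᶠ b) h s = cong₂ _∧ᵇ_ (eval-cong-Occ a (λ i → h i ∘ oandl) s) (eval-cong-Occ b (λ i → h i ∘ oandr) s)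
  eval-cong-Occ (◇ a)    h   = dia-cong (eval-cong-Occ a λ i → h i ∘ odia)
  eval-cong-Occ (□ a)    h   = box-cong (eval-cong-Occ a λ i → h i ∘ obox)
  eval-cong-Occ (μ a)    h   = mu-cong λ X → eval-cong-Occ a (∷-cong-Occ λ i → h i ∘ omu)
  eval-cong-Occ (ν a)    h   = nu-cong λ X → eval-cong-Occ a (∷-cong-Occ λ i → h i ∘ onu)

  -- Off `X` equality is demanded, because an `X`-free subformula may contain its variables
  -- negatively.
  record GrowsOn (X : ℕ → Bool) (ρ ρ′ : ℕ → S → Bool) : Set where
    field
      on  : ∀ i → X i ≡ true → ρ i ⊆ ρ′ i
      off : ∀ i → X i ≡ false → ∀ s → ρ i s ≡ ρ′ i s

  open GrowsOn

  GrowsOn-∷ : ∀ {E E′} → E ⊆ E′ → GrowsOn X ρ ρ′ → GrowsOn (extB X) (E ∷ₑ ρ) (E′ ∷ₑ ρ′)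
  on  (GrowsOn-∷ e g) zero    _ = e
  on  (GrowsOn-∷ e g) (suc i)   = on g i
  off (GrowsOn-∷ e g) (suc i)   = off g i

  ∨ᵇ-mono : ∀ {x x′ y y′} → (T x → T x′) → (T y → T y′) → T (x ∨ᵇ y) → T (x′ ∨ᵇ y′)
  ∨ᵇ-mono f g = from T-∨ ∘ Sum.map f g ∘ to T-∨

  ∧ᵇ-mono : ∀ {x x′ y y′} → (T x → T x′) → (T y → T y′) → T (x ∧ᵇ y) → T (x′ ∧ᵇ y′)
  ∧ᵇ-mono f g = from T-∧ ∘ Prod.map f g ∘ to T-∧

  Con-mono : Con X a → GrowsOn X ρ ρ′ → ⟦ a ⟧ ρ ⊆ ⟦ a ⟧ ρ′
  Con-mono (cvar {i} e) g = on g i e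
  Con-mono (cfree {a} _ f) g = ≗⇒⊆ (eval-cong-Occ a λ i o → off g i (f i o))
  Con-mono (cor c d)  g s = ∨ᵇ-mono (Con-mono c g s) (Con-mono d g s)
  Con-mono (cand c d) g s = ∧ᵇ-mono (Con-mono c g s) (Con-mono d g s)
  Con-mono (cdia c)   g = dia-mono (Con-mono c g)
  Con-mono (cmu c)    g = mu-mono λ X → Con-mono c (GrowsOn-∷ (λ _ → id) g)

  Cocon-mono : Cocon X a → GrowsOn X ρ ρ′ → ⟦ a ⟧ ρ ⊆ ⟦ a ⟧ ρ′
  Cocon-mono (kvar {i} e) g = on g i e
  Cocon-mono (kfree {a} _ f) g = ≗⇒⊆ (eval-cong-Occ a λ i o → off g i (f i o))
  Cocon-mono (kor c d)  g s = ∨ᵇ-mono (Cocon-mono c g s) (Cocon-mono d g s)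
  Cocon-mono (kand c d) g s = ∧ᵇ-mono (Cocon-mono c g s) (Cocon-mono d g s)
  Cocon-mono (kbox c)   g = box-mono (Cocon-mono c g)
  Cocon-mono (knu c)    g = nu-mono λ X → Cocon-mono c (GrowsOn-∷ (λ _ → id) g)

  GrowsOn-head : ∀ {E E′} → E ⊆ E′ → GrowsOn (extB X) (E ∷ₑ ρ) (E′ ∷ₑ ρ)
  GrowsOn-head e = GrowsOn-∷ e record { on = λ _ _ _ → id ; off = λ _ _ _ → refl }

  mu-least : ∀ X → (∀ t → T (Φ X t) → T (X t)) → mu Φ ⊆ X
  mu-least X pre s d = to (T-does (lem _)) d X pre

  nu-greatest : ∀ X → (∀ t → T (X t) → T (Φ X t)) → X ⊆ nu Φ
  nu-greatest X post s Xs = from (T-does (lem _)) (X , post , Xs)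

  -- The half of the Knaster-Tarski argument that rests on monotonicity, here supplied by
  -- `Con-mono`.
  μ-prefix : Con only0 a → ⟦ a ⟧ (⟦ μ a ⟧ ρ ∷ₑ ρ) ⊆ ⟦ μ a ⟧ ρ
  μ-prefix c s as = from (T-does (lem _)) λ X pre →
    pre s (Con-mono c (GrowsOn-head (mu-least X pre)) s as)

  ν-postfix : Cocon only0 a → ⟦ ν a ⟧ ρ ⊆ ⟦ a ⟧ (⟦ ν a ⟧ ρ ∷ₑ ρ)
  ν-postfix c s d with X , post , Xs ← to (T-does (lem _)) d =
    Cocon-mono c (GrowsOn-head (nu-greatest X post)) s (post s Xs)

-- Soundness

module Soundness (lem : LEM) (L : Fm → Set) (F : Frame) (F∈Fr : InFr lem L F) where

  open Semantics lem F

  private variable ρ : ℕ → St F → Bool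

  -- Truth at a fixed state is a valuation that respects `~`; this is how tautologies become valid.
  pval-eval : ∀ a {s} → pval (λ ψ → ⟦ ψ ⟧ ρ s) a ≡ ⟦ a ⟧ ρ s
  pval-eval (var i)  = refl
  pval-eval (nvar i) = refl
  pval-eval (a ∨ᶠ b) = cong₂ _∨ᵇ_ (pval-eval a) (pval-eval b)
  pval-eval (a ∧ᶠ b) = cong₂ _∧ᵇ_ (pval-eval a) (pval-eval b)
  pval-eval (◇ a)    = refl
  pval-eval (□ a)    = refl
  pval-eval (μ a)    = refl
  pval-eval (ν a)    = refl

  eval-⇔ᶠ : ∀ a b {s} → ⟦ a ⟧ ρ s ≡ ⟦ b ⟧ ρ s → T (⟦ a ⇔ᶠ b ⟧ ρ s)
  eval-⇔ᶠ {ρ = ρ} a b {s} e =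
    from (T-∧ {⟦ a ⇒ b ⟧ ρ s}) (from (eval-⇒ a b) (subst T e) , from (eval-⇒ b a) (subst T (sym e)))

  ⊤ᶠ-valid : ∀ V s → T (⟦ ⊤ᶠ ⟧ V s)
  ⊤ᶠ-valid V s with V 0 s
  ... | true  = _
  ... | false = _

  dia-∨ : ∀ f g s → dia (λ t → f t ∨ᵇ g t) s ≡ dia f s ∨ᵇ dia g s
  dia-∨ f g s = T⇔⇒≡ $ mk⇔
    (λ d → case to (T-does (lem _)) d of λ (t , rst , u) → from (T-∨ {dia f s}) $
       Sum.map (λ v → from (T-does (lem _)) (t , rst , v)) (λ v → from (T-does (lem _)) (t , rst , v))
               (to (T-∨ {f t}) u))
    ([ dia-mono (λ t → from (T-∨ {f t}) ∘ inj₁) s , dia-mono (λ t → from (T-∨ {f t}) ∘ inj₂) s ]′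
      ∘ to (T-∨ {dia f s}))

  box-∧ : ∀ f g s → box (λ t → f t ∧ᵇ g t) s ≡ box f s ∧ᵇ box g s
  box-∧ f g s = T⇔⇒≡ $ mk⇔
    (λ d → from (T-∧ {box f s}) (box-mono (λ t → proj₁ ∘ to (T-∧ {f t})) s d ,
                                 box-mono (λ t → proj₂ ∘ to (T-∧ {f t})) s d))
    (λ u → from (T-does (lem _)) λ t rst → case to (T-∧ {box f s}) u of λ (v , w) →
       from (T-∧ {f t}) (to (T-does (lem _)) v t rst , to (T-does (lem _)) w t rst))

  sound : L ⊢ φ → Valid lem F φ
  sound (ax l) = F∈Fr _ l
  sound (taut {φ} _ t) V s =
    subst T (pval-eval φ) (t (λ ψ → ⟦ ψ ⟧ V s) λ ψ → eval-~ ψ s)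
  sound ax-◇⊥ V s = from (T-does (lem _)) λ t _ → ⊤ᶠ-valid V t
  sound ax-◇∨ V s = eval-⇔ᶠ {ρ = V} (◇ (pv ∨ᶠ qv)) (◇ pv ∨ᶠ ◇ qv) (dia-∨ (V 0) (V 1) s)
  sound ax-□⊤ V s = from (T-does (lem _)) λ t _ → ⊤ᶠ-valid V t
  sound ax-□∧ V s = eval-⇔ᶠ {ρ = V} (□ (pv ∧ᶠ qv)) (□ pv ∧ᶠ □ qv) (box-∧ (V 0) (V 1) s)
  sound (ax-pre {φ} c) V s = from (eval-⇒ (φ [ μ φ /0]) (μ φ)) λ h →
    μ-prefix c s (subst T (eval-[/0] φ (μ φ) s) h)
  sound (ax-post {φ} c) V s = from (eval-⇒ (ν φ) (φ [ ν φ /0])) λ h →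
    subst T (sym (eval-[/0] φ (ν φ) s)) (ν-postfix c s h)
  sound (mp {φ} {ψ} p q) V s = to (eval-⇒ φ ψ) (sound q V s) (sound p V s)
  sound (mono◇ {φ} {ψ} p) V s = from (eval-⇒ (◇ φ) (◇ ψ))
    (dia-mono (λ t → to (eval-⇒ φ ψ) (sound p V t)) s)
  sound (mono□ {φ} {ψ} p) V s = from (eval-⇒ (□ φ) (□ ψ))
    (box-mono (λ t → to (eval-⇒ φ ψ) (sound p V t)) s)
  sound (usub {φ} σ _ p) V s = subst T (sym (eval-sub φ (λ _ _ → refl) s))
    (sound p (λ i → ⟦ σ i ⟧ V) s)
  sound (lfp {φ} {γ} _ _ p) V s = from (eval-⇒ (μ φ) γ) $
    mu-least (⟦ γ ⟧ V) (λ t h → to (eval-⇒ (φ [ γ /0]) γ) (sound p V t)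
      (subst T (sym (eval-[/0] φ γ t)) h)) s
  sound (gfp {φ} {γ} _ _ p) V s = from (eval-⇒ γ (ν φ)) $
    nu-greatest (⟦ γ ⟧ V) (λ t h → subst T (eval-[/0] φ γ t)
      (to (eval-⇒ γ (φ [ γ /0])) (sound p V t) h)) s

-- An enumeration of all formulas

-- Walks along the antidiagonals: down in the first component, then from `(zero , n)` to the start
-- of the next one.
step : ℕ × ℕ → ℕ × ℕ
step (zero  , n) = suc n , zero
step (suc m , n) = m , suc n

unpair : ℕ → ℕ × ℕ
unpair zero    = zero , zero
unpair (suc n) = step (unpair n)

unpair-surjective : ∀ m n → ∃ λ k → unpair k ≡ (m , n)
unpair-surjective m n = go (m + n) m n refl
  where
  -- Walks backwards, by recursion on the sum and then on the second component; the point before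
  -- `(suc m , zero)` is `(zero , m)`, on the previous antidiagonal.
  go : ∀ s m n → m + n ≡ s → ∃ λ k → unpair k ≡ (m , n)
  go zero    zero    zero    _  = zero , refl
  go (suc s) (suc m) zero    e  = Prod.map suc (cong step)
    (go s zero m (trans (sym (+-identityʳ m)) (suc-injective e)))
  go s       m       (suc n) e  = Prod.map suc (cong step) (go s (suc m) n (trans (sym (+-suc m n)) e))

depth : Fm → ℕ
depth (var i)  = 0
depth (nvar i) = 0
depth (a ∨ᶠ b) = suc (depth a ⊔ depth b)
depth (a ∧ᶠ b) = suc (depth a ⊔ depth b)
depth (◇ a)    = suc (depth a)
depth (□ a)    = suc (depth a)
depth (μ a)    = suc (depth a)
depth (ν a)    = suc (depth a)

mutual
  -- The first argument is fuel bounding the depth, which keeps the recursion structural; exhausted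
  -- fuel and unknown tags decode to `var 0`.
  decode : ℕ → ℕ → Fm
  decode d n = node d (unpair n)

  node : ℕ → ℕ × ℕ → Fm
  node d       (0 , n) = var n
  node d       (1 , n) = nvar n
  node (suc d) (2 , n) = decode d (proj₁ (unpair n)) ∨ᶠ decode d (proj₂ (unpair n))
  node (suc d) (3 , n) = decode d (proj₁ (unpair n)) ∧ᶠ decode d (proj₂ (unpair n))
  node (suc d) (4 , n) = ◇ decode d n
  node (suc d) (5 , n) = □ decode d n
  node (suc d) (6 , n) = μ decode d n
  node (suc d) (7 , n) = ν decode d n
  node _       _       = var 0

node-surjective : ∀ d t → (∃ λ n → node d (t , n) ≡ a) → ∃ λ k → decode d k ≡ a
node-surjective d t (n , e) with k , p ← unpair-surjective t n = k , trans (cong (node d) p) e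

decode-pair : ∀ d (_⊕_ : Fm → Fm → Fm) → (∃ λ k → decode d k ≡ a) → (∃ λ k → decode d k ≡ b) →
              ∃ λ n → (decode d (proj₁ (unpair n)) ⊕ decode d (proj₂ (unpair n))) ≡ (a ⊕ b)
decode-pair d _⊕_ (j , p) (k , q) with n , e ← unpair-surjective j k =
  n , cong₂ _⊕_ (trans (cong (decode d ∘ proj₁) e) p) (trans (cong (decode d ∘ proj₂) e) q)

decode-surjective : ∀ d a → depth a ≤ d → ∃ λ n → decode d n ≡ a
decode-surjective d (var i)  _ = node-surjective d 0 (i , refl)
decode-surjective d (nvar i) _ = node-surjective d 1 (i , refl)
decode-surjective (suc d) (a ∨ᶠ b) (s≤s l) = node-surjective (suc d) 2 $
  decode-pair d _∨ᶠ_ (decode-surjective d a (m⊔n≤o⇒m≤o _ _ l)) (decode-surjective d b (m⊔n≤o⇒n≤o (depth a) _ l))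
decode-surjective (suc d) (a ∧ᶠ b) (s≤s l) = node-surjective (suc d) 3 $
  decode-pair d _∧ᶠ_ (decode-surjective d a (m⊔n≤o⇒m≤o _ _ l)) (decode-surjective d b (m⊔n≤o⇒n≤o (depth a) _ l))
decode-surjective (suc d) (◇ a) (s≤s l) = node-surjective (suc d) 4 (Prod.map₂ (cong ◇_) (decode-surjective d a l))
decode-surjective (suc d) (□ a) (s≤s l) = node-surjective (suc d) 5 (Prod.map₂ (cong □_) (decode-surjective d a l))
decode-surjective (suc d) (μ a) (s≤s l) = node-surjective (suc d) 6 (Prod.map₂ (cong μ_) (decode-surjective d a l))
decode-surjective (suc d) (ν a) (s≤s l) = node-surjective (suc d) 7 (Prod.map₂ (cong ν_) (decode-surjective d a l))

abstract
  enum : ℕ → Fm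
  enum n = decode (proj₁ (unpair n)) (proj₂ (unpair n))

  enum-surjective : ∀ a → ∃ λ n → enum n ≡ a
  enum-surjective a with k , p ← decode-surjective (depth a) a ≤-refl
    with n , e ← unpair-surjective (depth a) k =
    n , trans (cong (λ mk → decode (proj₁ mk) (proj₂ mk)) e) p

-- Propositional entailment

Complemented : (Fm → Bool) → Set
Complemented v = ∀ ψ → v (~ ψ) ≡ not (v ψ)

pval-~ : Complemented v → ∀ a → pval v (~ a) ≡ not (pval v a)
pval-~ c (var i)  = c (var i)
pval-~ c (nvar i) = c (nvar i)
pval-~ c (a ∨ᶠ b) = trans (cong₂ _∧ᵇ_ (pval-~ c a) (pval-~ c b)) (sym (deMorgan₂ (pval _ a) _))
pval-~ c (a ∧ᶠ b) = trans (cong₂ _∨ᵇ_ (pval-~ c a) (pval-~ c b)) (sym (deMorgan₁ (pval _ a) _))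
pval-~ c (◇ a)    = c (◇ a)
pval-~ c (□ a)    = c (□ a)
pval-~ c (μ a)    = c (μ a)
pval-~ c (ν a)    = c (ν a)

module _ (c : Complemented v) where

  ⊩-~ : ∀ a → T (pval v (~ a)) ⇔ (¬ T (pval v a))
  ⊩-~ a rewrite pval-~ c a = T-not

  ⊩-⇒ : ∀ a b → T (pval v (a ⇒ b)) ⇔ (T (pval v a) → T (pval v b))
  ⊩-⇒ a b rewrite pval-~ c a = T-⇒ᵇ

⊩-∧ : ∀ a b → T (pval v (a ∧ᶠ b)) ⇔ (T (pval v a) × T (pval v b))
⊩-∧ {v} a b = T-∧ {pval v a}

⊩-∨ : ∀ a b → T (pval v (a ∨ᶠ b)) ⇔ (T (pval v a) ⊎ T (pval v b))
⊩-∨ {v} a b = T-∨ {pval v a}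

⊩-⊤ : ∀ v → Complemented v → T (pval v ⊤ᶠ)
⊩-⊤ v c = from (⊩-~ c ⊥ᶠ) λ t → case to (⊩-∧ {v} pv (nvar 0)) t of λ (p , q) → to (⊩-~ c pv) q p

⊩-conj : Complemented v → ∀ xs → T (pval v (conj xs)) ⇔ All (T ∘ pval v) xs
⊩-conj {v} c []       = mk⇔ (λ _ → []) (λ _ → ⊩-⊤ v c)
⊩-conj {v} c (x ∷ xs) = mk⇔
  (λ t → case to (⊩-∧ {v} x (conj xs)) t of λ (p , q) → p ∷ to (⊩-conj c xs) q)
  (λ { (p ∷ q) → from (⊩-∧ {v} x (conj xs)) (p , from (⊩-conj c xs) q) })

infix 3 _⊨_

-- Modal and fixpoint formulas count as atoms, tied only to their negations, exactly as in `Taut`.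
_⊨_ : List Fm → Fm → Set
xs ⊨ b = ∀ {v} → Complemented v → All (T ∘ pval v) xs → T (pval v b)

Taut-⇒ : ∀ a b → a ∷ [] ⊨ b → Taut (a ⇒ b)
Taut-⇒ a b h v c = from (⊩-⇒ c a b) λ t → h c (t ∷ [])

Basic-~ : Basic a → Basic (~ a)
Basic-~ bvar       = bnvar
Basic-~ bnvar      = bvar
Basic-~ (bor u v)  = band (Basic-~ u) (Basic-~ v)
Basic-~ (band u v) = bor (Basic-~ u) (Basic-~ v)
Basic-~ (bdia u)   = bbox (Basic-~ u)
Basic-~ (bbox u)   = bdia (Basic-~ u)

Basic-⇒ : Basic a → Basic b → Basic (a ⇒ b)
Basic-⇒ u v = bor (Basic-~ u) v

Basic-⊤ : Basic ⊤ᶠ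
Basic-⊤ = bor bnvar bvar

Basic-conj : All Basic xs → Basic (conj xs)
Basic-conj []       = Basic-⊤
Basic-conj (b ∷ bs) = band b (Basic-conj bs)

Basic⇒WF : Basic a → WF a
Basic⇒WF bvar       = wvar
Basic⇒WF bnvar      = wnvar
Basic⇒WF (bor u v)  = wor (Basic⇒WF u) (Basic⇒WF v)
Basic⇒WF (band u v) = wand (Basic⇒WF u) (Basic⇒WF v)
Basic⇒WF (bdia u)   = wdia (Basic⇒WF u)
Basic⇒WF (bbox u)   = wbox (Basic⇒WF u)

infix 4 _∈ˢ_

_∈ˢ_ : Fm → (Fm → Bool) → Set
φ ∈ˢ Γ = T (Γ φ)

-- Maximally consistent sets

module MaximalConsistency (lem : LEM) (L : Fm → Set) (N : NormalModalLogic L) where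

  open NormalModalLogic N using (basic; tauts; mpL; nec; usubL)

  L-∧ : L a → L b → L (a ∧ᶠ b)
  L-∧ {a} {b} p q = mpL _ _ q $ mpL _ _ p $
    tauts _ (Basic-⇒ A (Basic-⇒ B (band A B))) λ v c →
      from (⊩-⇒ c a (b ⇒ a ∧ᶠ b)) λ s → from (⊩-⇒ c b (a ∧ᶠ b)) λ t → from (⊩-∧ {v} a b) (s , t)
    where
    A = basic _ p
    B = basic _ q

  L-⊨ : a ∷ [] ⊨ b → Basic b → L a → L b
  L-⊨ {a} {b} h B p = mpL _ _ p (tauts _ (Basic-⇒ (basic _ p) B) (Taut-⇒ a b h))

  L-K : Basic a → Basic b → L (□ (a ⇒ b) ⇒ (□ a ⇒ □ b))
  -- In the axiom the double negation of `pv` has computed away before the substitution; in the goal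
  -- `~ (~ a)` is still there.
  L-K {a} {b} A B = subst (λ c → L (◇ (c ∧ᶠ ~ b) ∨ᶠ (◇ (~ a) ∨ᶠ □ b))) (sym (~-involutive a))
    (usubL (a ◂ b ◂ var) _ (λ { 0 → A ; 1 → B ; (suc (suc _)) → bvar }) (NormalModalLogic.K N))

  insert : (Fm → Bool) → Fm → Fm → Bool
  insert Γ χ φ = does (lem (φ ∈ˢ Γ ⊎ φ ≡ χ))

  insert⁻ : ∀ Γ → φ ∈ˢ insert Γ χ → φ ∈ˢ Γ ⊎ φ ≡ χ
  insert⁻ Γ = to (T-does (lem _))

  insert⁺ : ∀ Γ → φ ∈ˢ Γ → φ ∈ˢ insert Γ χ
  insert⁺ Γ = from (T-does (lem _)) ∘ inj₁

  insert-head : ∀ Γ → χ ∈ˢ insert Γ χ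
  insert-head Γ = from (T-does (lem _)) (inj₂ refl)

  insert-BasicSet : ∀ {Γ} → BasicSet Γ → Basic χ → BasicSet (insert Γ χ)
  insert-BasicSet {Γ = Γ} B b φ m with insert⁻ Γ m
  ... | inj₁ p    = B φ p
  ... | inj₂ refl = b

  -- Bookkeeping of the deduction theorem: all copies of `χ` in `ys` are gathered into one premise.
  insert⁻-All : ∀ Γ → All (_∈ˢ insert Γ χ) ys →
                ∃ λ xs → All (_∈ˢ Γ) xs × (χ ∷ xs ⊨ conj ys)
  insert⁻-All Γ [] = [] , [] , λ {v} c _ → ⊩-⊤ v c
  insert⁻-All {χ} {ys = y ∷ ys} Γ (m ∷ ms) with insert⁻-All Γ ms | insert⁻ Γ m
  ... | xs , ps , h | inj₂ refl = xs , ps , λ {v} c ts → from (⊩-∧ {v} y (conj ys)) (All.head ts , h c ts)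
  ... | xs , ps , h | inj₁ p    = y ∷ xs , p ∷ ps , λ { {v} c (t ∷ u ∷ ts) →
    from (⊩-∧ {v} y (conj ys)) (u , h c (t ∷ ts)) }

  insert-consistent : ∀ {Γ} → BasicSet Γ → Basic χ →
    (∀ xs → All (_∈ˢ Γ) xs → ¬ L (conj xs ⇒ ~ χ)) → Consistent L (insert Γ χ)
  insert-consistent {χ} {Γ} BΓ B h ys ms l with insert⁻-All Γ ms
  ... | xs , ps , e = h xs ps $ L-⊨ (λ { c (t ∷ []) →
          from (⊩-⇒ c (conj xs) (~ χ)) λ u → from (⊩-~ c χ) λ w →
            to (⊩-~ c (conj ys)) t (e c (w ∷ to (⊩-conj c xs) u)) })
        (Basic-⇒ (Basic-conj (All.map (BΓ _) ps)) (Basic-~ B)) l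

  module Lindenbaum (Γ : Fm → Bool) (BΓ : BasicSet Γ) (CΓ : Consistent L Γ) where

    Addable : (Fm → Bool) → Fm → Set
    Addable Δ χ = Basic χ × Consistent L (insert Δ χ)

    stage : ℕ → Fm → Bool
    stage zero    = Γ
    stage (suc n) = if does (lem (Addable (stage n) (enum n))) then insert (stage n) (enum n) else stage n

    stage-Basic : ∀ n → BasicSet (stage n)
    stage-Basic zero = BΓ
    stage-Basic (suc n) with lem (Addable (stage n) (enum n))
    ... | yes (b , _) = insert-BasicSet (stage-Basic n) b
    ... | no _        = stage-Basic n

    stage-Consistent : ∀ n → Consistent L (stage n)
    stage-Consistent zero = CΓ
    stage-Consistent (suc n) with lem (Addable (stage n) (enum n))
    ... | yes (_ , c) = c
    ... | no _        = stage-Consistent n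

    stage-step : ∀ n → φ ∈ˢ stage n → φ ∈ˢ stage (suc n)
    stage-step n p with does (lem (Addable (stage n) (enum n)))
    ... | true  = insert⁺ (stage n) p
    ... | false = p

    stage-mono : ∀ {m n} → m ≤′ n → φ ∈ˢ stage m → φ ∈ˢ stage n
    stage-mono ≤′-refl          p = p
    stage-mono (≤′-step {n} le) p = stage-step n (stage-mono le p)

    limit : Fm → Bool
    limit φ = does (lem (∃ λ n → φ ∈ˢ stage n))

    ∈-limit : ∀ n → φ ∈ˢ stage n → φ ∈ˢ limit
    ∈-limit n p = from (T-does (lem _)) (n , p)

    -- A finite list uses finitely many stages, so consistency, which looks at finite lists only,
    -- passes to the limit.
    limit-compact : All (_∈ˢ limit) xs → ∃ λ n → All (_∈ˢ stage n) xs
    limit-compact [] = 0 , []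
    limit-compact (m ∷ ms) with to (T-does (lem _)) m | limit-compact ms
    ... | j , p | k , ps = j ⊔ k , stage-mono (≤⇒≤′ (m≤m⊔n j k)) p
                                 ∷ All.map (stage-mono (≤⇒≤′ (m≤n⊔m j k))) ps

    limit-maximal : MaxConsistent L limit
    limit-maximal = (λ φ m → case to (T-does (lem _)) m of λ (n , p) → stage-Basic n φ p) ,
                    (λ xs ms → case limit-compact ms of λ (n , ps) → stage-Consistent n xs ps) ,
                    maximal
      where
      maximal : (Δ : Fm → Bool) → (∀ φ → φ ∈ˢ limit → φ ∈ˢ Δ) → BasicSet Δ →
                Consistent L Δ → ∀ φ → φ ∈ˢ Δ → φ ∈ˢ limit
      maximal Δ sub BΔ CΔ φ m with n , refl ← enum-surjective φ = ∈-limit (suc n) added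
        where
        -- `insert (stage n) (enum n)` lies inside the consistent `Δ`, so the formula was accepted
        -- when its turn came.
        addable : Addable (stage n) (enum n)
        addable = BΔ _ m , λ xs ms → CΔ xs (All.map
          (λ p → [ sub _ ∘ ∈-limit n , (λ { refl → m }) ]′ (insert⁻ (stage n) p)) ms)

        added : enum n ∈ˢ stage (suc n)
        added with lem (Addable (stage n) (enum n))
        ... | yes _ = insert-head (stage n)
        ... | no ¬a = contradiction addable ¬a

  lindenbaum : ∀ Γ → BasicSet Γ → Consistent L Γ →
               ∃ λ Δ → MaxConsistent L Δ × (∀ φ → φ ∈ˢ Γ → φ ∈ˢ Δ)
  lindenbaum Γ BΓ CΓ = limit , limit-maximal , λ φ → ∈-limit 0
    where open Lindenbaum Γ BΓ CΓ

  module MCS {Γ : Fm → Bool} (M : MaxConsistent L Γ) where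

    ∈-Basic : φ ∈ˢ Γ → Basic φ
    ∈-Basic = proj₁ M _

    refuted : Basic φ → ¬ φ ∈ˢ Γ → ∃ λ xs → All (_∈ˢ Γ) xs × L (conj xs ⇒ ~ φ)
    refuted {φ} B φ∉ = decidable-stable (lem _) λ h → φ∉ $
      proj₂ (proj₂ M) (insert Γ φ) (λ _ → insert⁺ Γ) (insert-BasicSet (proj₁ M) B)
        (insert-consistent (proj₁ M) B λ xs ps l → h (xs , ps , l)) φ (insert-head Γ)

    -- If `φ` were missing, maximality would give premises in `Γ` refuting it, and together with
    -- `xs` these would be inconsistent.
    closed : Basic φ → All (_∈ˢ Γ) xs → L (conj xs ⇒ φ) → φ ∈ˢ Γ
    closed {φ} {xs} B ps l = decidable-stable (T? _) λ φ∉ → case refuted B φ∉ of λ (ys , qs , l′) →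
      proj₁ (proj₂ M) (ys ++ xs) (++⁺ qs ps) $
        L-⊨ (λ { {v} c (t ∷ []) → from (⊩-~ c (conj (ys ++ xs))) λ u →
                 case to (⊩-∧ {v} (conj xs ⇒ φ) (conj ys ⇒ ~ φ)) t of λ (i , j) →
                 case ++⁻ ys (to (⊩-conj c (ys ++ xs)) u) of λ (y , x) →
                   to (⊩-~ c φ) (to (⊩-⇒ c (conj ys) (~ φ)) j (from (⊩-conj c ys) y))
                     (to (⊩-⇒ c (conj xs) φ) i (from (⊩-conj c xs) x)) })
            (Basic-~ (Basic-conj (All.map ∈-Basic (++⁺ qs ps)))) (L-∧ l l′)

    entailed : Basic φ → All (_∈ˢ Γ) xs → xs ⊨ φ → φ ∈ˢ Γ
    entailed {φ} {xs} B ps h = closed B ps $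
      tauts _ (Basic-⇒ (Basic-conj (All.map ∈-Basic ps)) B)
        (Taut-⇒ (conj xs) φ λ { c (t ∷ []) → h c (to (⊩-conj c xs) t) })

    theorem : L φ → φ ∈ˢ Γ
    theorem {φ} l = closed {xs = []} (basic _ l) [] $
      L-⊨ (λ { c (t ∷ []) → from (⊩-⇒ c ⊤ᶠ φ) λ _ → t }) (Basic-⇒ Basic-⊤ (basic _ l)) l

    ∈-mp : Basic ψ → (φ ⇒ ψ) ∈ˢ Γ → φ ∈ˢ Γ → ψ ∈ˢ Γ
    ∈-mp {ψ} {φ} B p q = entailed B (p ∷ q ∷ []) λ { c (s ∷ t ∷ []) → to (⊩-⇒ c φ ψ) s t }

    ∈-~ : Basic φ → (~ φ) ∈ˢ Γ ⇔ (¬ φ ∈ˢ Γ)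
    ∈-~ {φ} B = mk⇔
      (λ n p → proj₁ (proj₂ M) (φ ∷ ~ φ ∷ []) (p ∷ n ∷ []) $
        tauts _ (Basic-~ (Basic-conj {φ ∷ ~ φ ∷ []} (B ∷ Basic-~ B ∷ []))) λ v c →
          from (⊩-~ c (conj (φ ∷ ~ φ ∷ []))) λ t → case to (⊩-conj c (φ ∷ ~ φ ∷ [])) t of λ
            { (u ∷ w ∷ []) → to (⊩-~ c φ) w u })
      (λ φ∉ → case refuted B φ∉ of λ (xs , ps , l) → closed (Basic-~ B) ps l)

    ∈-∧ : (a ∧ᶠ b) ∈ˢ Γ ⇔ (a ∈ˢ Γ × b ∈ˢ Γ)
    ∈-∧ {a} {b} = mk⇔
      (λ p → case ∈-Basic p of λ { (band A B) →
        entailed A (p ∷ []) (λ { {v} c (t ∷ []) → proj₁ (to (⊩-∧ {v} a b) t) }) ,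
        entailed B (p ∷ []) (λ { {v} c (t ∷ []) → proj₂ (to (⊩-∧ {v} a b) t) }) })
      (λ (p , q) → entailed (band (∈-Basic p) (∈-Basic q)) (p ∷ q ∷ [])
        λ { {v} c (s ∷ t ∷ []) → from (⊩-∧ {v} a b) (s , t) })

    ∈-∨ : Basic (a ∨ᶠ b) → (a ∨ᶠ b) ∈ˢ Γ ⇔ (a ∈ˢ Γ ⊎ b ∈ˢ Γ)
    ∈-∨ {a} {b} (bor A B) = mk⇔
      (λ p → case T? (Γ a) of λ
        { (yes q) → inj₁ q
        ; (no q)  → inj₂ $ entailed B (p ∷ from (∈-~ A) q ∷ []) λ { {v} c (s ∷ t ∷ []) →
            [ (λ u → contradiction u (to (⊩-~ c a) t)) , id ]′ (to (⊩-∨ {v} a b) s) } })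
      [ (λ p → entailed (bor A B) (p ∷ []) λ { {v} c (t ∷ []) → from (⊩-∨ {v} a b) (inj₁ t) }) ,
        (λ p → entailed (bor A B) (p ∷ []) λ { {v} c (t ∷ []) → from (⊩-∨ {v} a b) (inj₂ t) }) ]′

    ∈-K : □ (a ⇒ b) ∈ˢ Γ → □ a ∈ˢ Γ → □ b ∈ˢ Γ
    ∈-K p q with bbox B ← ∈-Basic q | bbox (bor _ C) ← ∈-Basic p =
      ∈-mp (bbox C) (∈-mp (Basic-⇒ (bbox B) (bbox C)) (theorem (L-K B C)) p) q

    ∈-□-mono : Basic b → L (a ⇒ b) → □ a ∈ˢ Γ → □ b ∈ˢ Γ
    ∈-□-mono B l = ∈-K (theorem (nec _ l))

    ∈-□-conj : All (λ x → □ x ∈ˢ Γ) xs → □ conj xs ∈ˢ Γ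
    ∈-□-conj [] = theorem (nec _ (tauts _ Basic-⊤ ⊩-⊤))
    ∈-□-conj {x ∷ xs} (p ∷ ps) with bbox B ← ∈-Basic p | q ← ∈-□-conj ps with bbox C ← ∈-Basic q =
      ∈-K (∈-K (theorem (nec _ (tauts _ (Basic-⇒ B (Basic-⇒ C (band B C))) λ v c →
        from (⊩-⇒ c x (conj xs ⇒ x ∧ᶠ conj xs)) λ s → from (⊩-⇒ c (conj xs) (x ∧ᶠ conj xs)) λ t →
          from (⊩-∧ {v} x (conj xs)) (s , t)))) p) q

    -- If formulas boxed in `Γ` refuted `χ`, normality would put `□ (~ χ)`, the negation of `◇ χ`,
    -- into `Γ`.
    ◇-witness : ◇ χ ∈ˢ Γ → ∃ λ Δ → MaxConsistent L Δ × (∀ φ → □ φ ∈ˢ Γ → φ ∈ˢ Δ) × χ ∈ˢ Δ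
    ◇-witness {χ} d with bdia B ← ∈-Basic d =
      case lindenbaum (insert Γ□ χ) (insert-BasicSet BΓ□ B) (insert-consistent BΓ□ B λ xs ps l →
          to (∈-~ (bdia B)) (∈-□-mono (Basic-~ B) l (∈-□-conj ps)) d) of λ
        (Δ , MΔ , sub) → Δ , MΔ , (λ φ → sub φ ∘ insert⁺ Γ□) , sub χ (insert-head Γ□)
      where
      Γ□ : Fm → Bool
      Γ□ φ = Γ (□ φ)

      BΓ□ : BasicSet Γ□
      BΓ□ φ m with bbox B ← ∈-Basic m = B

-- Completeness

module _ {L : Fm → Set} where

  ⊢-id : WF ψ → L ⊢ ψ ⇒ ψ
  ⊢-id {ψ} w = taut (wor (WF-negK w) w) (Taut-⇒ ψ ψ λ { c (t ∷ []) → t })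

  ⊢-⊤ : L ⊢ ⊤ᶠ
  ⊢-⊤ = taut (wor wnvar wvar) ⊩-⊤

  ⊢-const : WF a → WF b → L ⊢ b → L ⊢ a ⇒ b
  ⊢-const {a} {b} u w p = mp p $ taut (wor (WF-negK w) (wor (WF-negK u) w)) $
    Taut-⇒ b (a ⇒ b) λ { c (t ∷ []) → from (⊩-⇒ c a b) λ _ → t }

  -- Necessitation is not a rule of the calculus; monotonicity applied to `⊤ᶠ ⇒ φ` yields it from
  -- `□ ⊤ᶠ`.
  ⊢-nec : WF φ → L ⊢ φ → L ⊢ □ φ
  ⊢-nec w p = mp {φ = □ ⊤ᶠ} ax-□⊤ (mono□ {φ = ⊤ᶠ} (⊢-const {a = ⊤ᶠ} (wor wnvar wvar) w p))

  ⊢-∧ : WF a → WF b → L ⊢ a → L ⊢ b → L ⊢ a ∧ᶠ b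
  ⊢-∧ {a} {b} u w p q = mp q $ mp p $
    taut (wor (WF-negK u) (wor (WF-negK w) (wand u w))) λ v c →
      from (⊩-⇒ c a (b ⇒ a ∧ᶠ b)) λ s → from (⊩-⇒ c b (a ∧ᶠ b)) λ t → from (⊩-∧ {v} a b) (s , t)

-- Generated subframes and basic formulas

module GeneratedSubframe (lem : LEM) (F : Frame) (P : St F → Bool)
  (P-closed : ∀ {s t} → Rel F s t → T (P s) → T (P t)) where

  subframe : Frame
  subframe = frame (Σ (St F) (T ∘ P)) (λ s t → Rel F (proj₁ s) (proj₁ t))

  private
    module F = Semantics lem F
    module G = Semantics lem subframe

  -- The value off `P` is arbitrary, as no step leads out of `P`.
  extend : (ℕ → St subframe → Bool) → ℕ → St F → Bool
  extend V i s with T? (P s)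
  ... | yes p = V i (s , p)
  ... | no _  = false

  extend-proj₁ : ∀ V i s → V i s ≡ extend V i (proj₁ s)
  extend-proj₁ V i (s , p) with T? (P s)
  ... | yes p′ = cong (λ p → V i (s , p)) (T-irrelevant p p′)
  ... | no ¬p  = contradiction p ¬p

  eval-extend : ∀ V → Basic φ → ∀ s → G.⟦ φ ⟧ V s ≡ F.⟦ φ ⟧ (extend V) (proj₁ s)
  eval-extend V (bvar {i})  s = extend-proj₁ V i s
  eval-extend V (bnvar {i}) s = cong not (extend-proj₁ V i s)
  eval-extend V (bor u v)   s = cong₂ _∨ᵇ_ (eval-extend V u s) (eval-extend V v s)
  eval-extend V (band u v)  s = cong₂ _∧ᵇ_ (eval-extend V u s) (eval-extend V v s)
  eval-extend V (bdia u) (s , p) = does-⇔ (mk⇔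
    (λ ((t , q) , r , e) → t , r , subst T (eval-extend V u (t , q)) e)
    (λ (t , r , e) → (t , P-closed r p) , r , subst T (sym (eval-extend V u (t , P-closed r p))) e)) (lem _) (lem _)
  eval-extend V (bbox u) (s , p) = does-⇔ (mk⇔
    (λ h t r → subst T (eval-extend V u (t , P-closed r p)) (h (t , P-closed r p) r))
    (λ h (t , q) r → subst T (sym (eval-extend V u (t , q))) (h t r))) (lem _) (lem _)

  subframe-InFr : ∀ {L} → (∀ φ → L φ → Basic φ) → InFr lem L F → InFr lem L subframe
  subframe-InFr B h φ l V s = subst T (sym (eval-extend V (B φ l) s)) (h φ l (extend V) (proj₁ s))

-- The canonical model over names of formulas

module Completeness (lem : LEM) (L : Fm → Set) (N : NormalModalLogic L)
  (canonical : Canonical lem L) (filtrable : AdmitsFiltration lem L) where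

  open NormalModalLogic N using (basic)
  open MaximalConsistency lem L N

  -- A well-formed formula ψ is named by the variable ⌜ ψ ⌝, so that basic
  -- formulas can speak about fixpoint formulas.

  name : ℕ → Fm
  name n with lem (WF (enum n))
  ... | yes _ = enum n
  ... | no _  = var 0

  -- The default in `name` is there for this: `usub` accepts only well-formed substitutions.
  name-WF : ∀ n → WF (name n)
  name-WF n with lem (WF (enum n))
  ... | yes w = w
  ... | no _  = wvar

  code : Fm → ℕ
  code ψ = proj₁ (enum-surjective ψ)

  ⌜_⌝ : Fm → Fm
  ⌜ ψ ⌝ = var (code ψ)

  name-code : WF ψ → name (code ψ) ≡ ψ
  name-code {ψ} w with lem (WF (enum (code ψ)))
  ... | yes _ = proj₂ (enum-surjective ψ)
  ... | no ¬w = contradiction (subst WF (sym (proj₂ (enum-surjective ψ))) w) ¬w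

  sub-name-WF : Basic χ → WF (sub name χ)
  sub-name-WF B = WF-sub name-WF (Basic⇒WF B)

  ContainsTheory : (Fm → Bool) → Set
  ContainsTheory Γ = ∀ χ → Basic χ → L ⊢ sub name χ → χ ∈ˢ Γ

  containsTheory : St (CanonicalFrame L) → Bool
  containsTheory Γ = does (lem (ContainsTheory (proj₁ Γ)))

  -- `sub name` commutes with □, so by necessitation `□ χ` belongs to `Γ` whenever `χ` translates to
  -- a theorem.
  containsTheory-closed : ∀ {Γ Δ} → Rel (CanonicalFrame L) Γ Δ →
                          T (containsTheory Γ) → T (containsTheory Δ)
  containsTheory-closed R t = from (T-does (lem _)) λ χ B p →
    R χ (to (T-does (lem _)) t (□ χ) (bbox B) (⊢-nec (sub-name-WF B) p))

  open GeneratedSubframe lem (CanonicalFrame L) containsTheory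
    (λ {Γ} {Δ} → containsTheory-closed {Γ} {Δ})

  World : Set
  World = St subframe

  set : World → Fm → Bool
  set w = proj₁ (proj₁ w)

  private
    variable
      w u : World
    module M (w : World) = MCS (proj₂ (proj₁ w))

  _∋_ : World → Fm → Set
  w ∋ ψ = ⌜ ψ ⌝ ∈ˢ set w

  theory : ∀ w → Basic χ → L ⊢ sub name χ → χ ∈ˢ set w
  theory w B p = to (T-does (lem _)) (proj₂ w) _ B p

  -- Ties a basic compound of names to the name of the compound: both translate to `ψ`, so each
  -- implication between them translates to `ψ ⇒ ψ`.
  ∋-name : ∀ w → Basic χ → WF ψ → sub name χ ≡ ψ → χ ∈ˢ set w ⇔ w ∋ ψ
  ∋-name {χ} {ψ} w B W refl = mk⇔
    (M.∈-mp w bvar $ theory w (Basic-⇒ B bvar) $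
      subst₂ (λ x y → L ⊢ x ∨ᶠ y) (sym (sub-~ name χ)) (sym (name-code W)) (⊢-id W))
    (M.∈-mp w B $ theory w (Basic-⇒ bvar B) $
      subst (λ x → L ⊢ ~ x ∨ᶠ sub name χ) (sym (name-code W)) (⊢-id W))

  ∋-theorem : ∀ w → WF ψ → L ⊢ ψ → w ∋ ψ
  ∋-theorem w W p = theory w bvar (subst (L ⊢_) (sym (name-code W)) p)

  ∋-~ : ∀ w → WF ψ → w ∋ (~ ψ) ⇔ (¬ w ∋ ψ)
  ∋-~ w W = ⇔-trans (⇔-sym (∋-name w bnvar (WF-negK W) (cong ~_ (name-code W)))) (M.∈-~ w bvar)

  ∋-∧ : ∀ w → WF a → WF b → w ∋ (a ∧ᶠ b) ⇔ (w ∋ a × w ∋ b)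
  ∋-∧ w A B = ⇔-trans
    (⇔-sym (∋-name w (band bvar bvar) (wand A B) (cong₂ _∧ᶠ_ (name-code A) (name-code B)))) (M.∈-∧ w)

  ∋-∨ : ∀ w → WF a → WF b → w ∋ (a ∨ᶠ b) ⇔ (w ∋ a ⊎ w ∋ b)
  ∋-∨ w A B = ⇔-trans
    (⇔-sym (∋-name w (bor bvar bvar) (wor A B) (cong₂ _∨ᶠ_ (name-code A) (name-code B))))
    (M.∈-∨ w (bor bvar bvar))

  ∋-⇒ : ∀ w → WF a → WF b → w ∋ (a ⇒ b) ⇔ (w ∋ a → w ∋ b)
  ∋-⇒ {a} w A B = mk⇔
    (λ p q → [ (λ n → contradiction q (to (∋-~ w A) n)) , id ]′ (to (∋-∨ w (WF-negK A) B) p))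
    (λ h → from (∋-∨ w (WF-negK A) B) $ case T? (set w ⌜ a ⌝) of λ
      { (yes q) → inj₂ (h q) ; (no ¬q) → inj₁ (from (∋-~ w A) ¬q) })

  ∋-mp : ∀ w → WF a → WF b → L ⊢ a ⇒ b → w ∋ a → w ∋ b
  ∋-mp w A B p = to (∋-⇒ w A B) (∋-theorem w (wor (WF-negK A) B) p)

  witness : ∀ w → ◇ χ ∈ˢ set w → ∃ λ u → Rel subframe w u × χ ∈ˢ set u
  witness w d = case M.◇-witness w d of λ (Δ , MΔ , R , m) →
    ((Δ , MΔ) , containsTheory-closed {proj₁ w} {Δ , MΔ} R (proj₂ w)) , R , m

  ∋-□ : ∀ w → WF a → w ∋ (□ a) ⇔ (∀ u → Rel subframe w u → u ∋ a)
  ∋-□ w A = ⇔-trans (⇔-sym (∋-name w (bbox bvar) (wbox A) (cong □_ (name-code A)))) $ mk⇔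
    (λ p u R → R _ p)
    (λ h → decidable-stable (T? _) λ n →
      case witness w (from (M.∈-~ w (bbox bvar)) n) of λ (u , R , m) →
        to (M.∈-~ u bvar) m (h u R))

  ∋-◇ : ∀ w → WF a → w ∋ (◇ a) ⇔ (∃ λ u → Rel subframe w u × u ∋ a)
  ∋-◇ {a} w A = ⇔-trans (⇔-sym (∋-name w (bdia bvar) (wdia A) (cong ◇_ (name-code A)))) $ mk⇔
    (witness w)
    (λ (u , R , m) → decidable-stable (T? _) λ n →
      to (M.∈-~ u bvar) (R (~ ⌜ a ⌝) (from (M.∈-~ w (bdia bvar)) n)) m)

  ⊢-sub-conj : All Basic xs → All (λ x → L ⊢ sub name x) xs → L ⊢ sub name (conj xs)
  ⊢-sub-conj []       []       = usub name name-WF ⊢-⊤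
  ⊢-sub-conj (B ∷ Bs) (p ∷ ps) =
    ⊢-∧ (sub-name-WF B) (sub-name-WF (Basic-conj Bs)) p (⊢-sub-conj Bs ps)

  ∋-complete : WF ψ → (∀ w → w ∋ ψ) → L ⊢ ψ
  ∋-complete {ψ} W h = decidable-stable (lem _) λ ⊬ψ →
    case lindenbaum (insert Θ (~ ⌜ ψ ⌝)) (insert-BasicSet BΘ bnvar)
           (insert-consistent BΘ bnvar λ xs ps l → ⊬ψ (derive xs (All.map (to (T-does (lem _))) ps) l)) of λ
      (Γ , MΓ , sub) → let
        w : World
        w = (Γ , MΓ) , from (T-does (lem _)) λ χ B p →
              sub χ (insert⁺ Θ (from (T-does (lem _)) (B , p)))
      in to (M.∈-~ w bvar) (sub _ (insert-head Θ)) (h w)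
    where
    Θ : Fm → Bool
    Θ χ = does (lem (Basic χ × (L ⊢ sub name χ)))

    BΘ : BasicSet Θ
    BΘ χ = proj₁ ∘ to (T-does (lem _))

    derive : ∀ xs → All (λ χ → Basic χ × (L ⊢ sub name χ)) xs → L (conj xs ⇒ ⌜ ψ ⌝) → L ⊢ ψ
    derive xs ps l = mp (⊢-sub-conj (All.map proj₁ ps) (All.map proj₂ ps)) $
      subst₂ (λ x y → L ⊢ x ∨ᶠ y) (sub-~ name (conj xs)) (name-code W) (usub name name-WF (ax l))

  V : ℕ → World → Bool
  V i w = set w (var i)

  private module G = Semantics lem subframe

  -- Truth lemma of the canonical model for basic formulas. A filtration compares worlds by truth;
  -- this turns the comparison into one by membership.
  eval-name : ∀ w → Basic χ → T (G.⟦ χ ⟧ V w) ⇔ w ∋ sub name χ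
  eval-name w (bvar {i})  = ∋-name w bvar (name-WF i) refl
  eval-name w (bnvar {i}) = ⇔-trans T-not (⇔-trans (⇔-sym (M.∈-~ w bvar))
                              (∋-name w bnvar (WF-negK (name-WF i)) refl))
  eval-name w (bor {a} {b} A B) = ⇔-trans (T-∨ {G.⟦ a ⟧ V w}) $ mk⇔
    (from (∋-∨ w (sub-name-WF A) (sub-name-WF B)) ∘ Sum.map (to (eval-name w A)) (to (eval-name w B)))
    (Sum.map (from (eval-name w A)) (from (eval-name w B)) ∘ to (∋-∨ w (sub-name-WF A) (sub-name-WF B)))
  eval-name w (band {a} {b} A B) = ⇔-trans (T-∧ {G.⟦ a ⟧ V w}) $ mk⇔
    (from (∋-∧ w (sub-name-WF A) (sub-name-WF B)) ∘ Prod.map (to (eval-name w A)) (to (eval-name w B)))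
    (Prod.map (from (eval-name w A)) (from (eval-name w B)) ∘ to (∋-∧ w (sub-name-WF A) (sub-name-WF B)))
  eval-name w (bdia A) = ⇔-trans (T-does (lem _)) $ mk⇔
    (λ (u , R , m) → from (∋-◇ w (sub-name-WF A)) (u , R , to (eval-name u A) m))
    (λ p → case to (∋-◇ w (sub-name-WF A)) p of λ (u , R , m) → u , R , from (eval-name u A) m)
  eval-name w (bbox A) = ⇔-trans (T-does (lem _)) $ mk⇔
    (λ h → from (∋-□ w (sub-name-WF A)) λ u R → to (eval-name u A) (h u R))
    (λ p u R → from (eval-name u A) (to (∋-□ w (sub-name-WF A)) p u R))

  -- Definable sets of worlds

  Agree : List Fm → World → World → Set
  Agree Λ w u = All (λ ψ → w ∋ ψ ⇔ u ∋ ψ) Λ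

  -- Shannon expansion along `Λ`. `P₁` and `P₀` take the points of `P` with and without `ψ` and
  -- saturate them under agreement on the remaining formulas, so the induction applies. With nothing
  -- left to agree on, `P` holds everywhere or nowhere.
  definable : ∀ {Λ} → All WF Λ → (P : World → Bool) →
              (∀ w u → Agree Λ w u → T (P w) → T (P u)) →
              ∃ λ γ → WF γ × (∀ w → T (P w) ⇔ w ∋ γ)
  definable [] P inv with lem (∃ λ w → T (P w))
  ... | yes (u , Pu) = ⊤ᶠ , wor wnvar wvar , λ w →
          mk⇔ (λ _ → ∋-theorem w (wor wnvar wvar) ⊢-⊤) (λ _ → inv u w [] Pu)
  ... | no ¬P = ⊥ᶠ , wand wvar wnvar , λ w →
          mk⇔ (λ p → contradiction (w , p) ¬P)
              (λ m → contradiction m (to (∋-~ {⊥ᶠ} w (wand wvar wnvar)) (∋-theorem w (wor wnvar wvar) ⊢-⊤)))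
  definable {ψ ∷ Λ} (W ∷ Ws) P inv =
    case definable Ws P₁ P₁-inv of λ (γ₁ , W₁ , d₁) → case definable Ws P₀ P₀-inv of λ (γ₀ , W₀ , d₀) →
        (ψ ∧ᶠ γ₁) ∨ᶠ (~ ψ ∧ᶠ γ₀) , wor (wand W W₁) (wand (WF-negK W) W₀) , λ w → mk⇔
          (λ Pw → from (∋-∨ w (wand W W₁) (wand (WF-negK W) W₀)) $ case T? (set w ⌜ ψ ⌝) of λ
            { (yes m) → inj₁ (from (∋-∧ w W W₁) (m , to (d₁ w) (from (T-does (lem _)) (w , Pw , m , self w))))
            ; (no n)  → inj₂ (from (∋-∧ w (WF-negK W) W₀)
                (from (∋-~ w W) n , to (d₀ w) (from (T-does (lem _)) (w , Pw , n , self w)))) })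
          (λ p → case to (∋-∨ w (wand W W₁) (wand (WF-negK W) W₀)) p of λ
            { (inj₁ q) → case to (∋-∧ w W W₁) q of λ (m , g) →
                case to (T-does (lem _)) (from (d₁ w) g) of λ (u , Pu , m′ , e) →
                  inv u w (mk⇔ (λ _ → m) (λ _ → m′) ∷ e) Pu
            ; (inj₂ q) → case to (∋-∧ w (WF-negK W) W₀) q of λ (m , g) →
                case to (T-does (lem _)) (from (d₀ w) g) of λ (u , Pu , n′ , e) →
                  inv u w (mk⇔ (λ p → contradiction p n′) (λ p → contradiction p (to (∋-~ w W) m)) ∷ e) Pu })
    where
    P₁ P₀ : World → Bool
    P₁ w = does (lem (∃ λ u → T (P u) × u ∋ ψ × Agree Λ u w))
    P₀ w = does (lem (∃ λ u → T (P u) × ¬ (u ∋ ψ) × Agree Λ u w))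

    P₁-inv : ∀ w u → Agree Λ w u → T (P₁ w) → T (P₁ u)
    P₁-inv w u e p = case to (T-does (lem _)) p of λ (t , Pt , m , f) →
      from (T-does (lem _)) (t , Pt , m , All.zipWith (λ (h , k) → ⇔-trans h k) (f , e))

    P₀-inv : ∀ w u → Agree Λ w u → T (P₀ w) → T (P₀ u)
    P₀-inv w u e p = case to (T-does (lem _)) p of λ (t , Pt , m , f) →
      from (T-does (lem _)) (t , Pt , m , All.zipWith (λ (h , k) → ⇔-trans h k) (f , e))

    self : ∀ w → Agree Λ w w
    self w = All.universal (λ _ → ⇔-refl) Λ

  -- The filtration is taken through a set of basic formulas about the names of
  -- an unravelled Fischer-Ladner closure: τ records how the bound variables met
  -- so far are to be unfolded.

  mutual
    closure : (ℕ → Fm) → Fm → List Fm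
    closure τ φ = sub τ φ ∷ below τ φ

    below : (ℕ → Fm) → Fm → List Fm
    below τ (var i)  = []
    below τ (nvar i) = τ i ∷ []
    below τ (a ∨ᶠ b) = closure τ a ++ closure τ b
    below τ (a ∧ᶠ b) = closure τ a ++ closure τ b
    below τ (◇ a)    = closure τ a
    below τ (□ a)    = closure τ a
    below τ (μ a)    = closure (sub τ (μ a) ◂ τ) a
    below τ (ν a)    = closure (sub τ (ν a) ◂ τ) a

  -- Serves the final step, where a free variable takes an `extension` as its value, which must
  -- agree with membership. It is why `below` lists `τ i` under `nvar i`: the head `~ τ i` would not
  -- supply it.
  Occ-closure : ∀ {τ} φ → Occ i φ → τ i ∈ closure τ φ
  Occ-closure (var i)  ovar      = here refl
  Occ-closure (nvar i) onvar     = there (here refl)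
  Occ-closure (a ∨ᶠ b) (oorl o)  = there (∈-++⁺ˡ (Occ-closure a o))
  Occ-closure {τ = τ} (a ∨ᶠ b) (oorr o)  = there (∈-++⁺ʳ (closure τ a) (Occ-closure b o))
  Occ-closure (a ∧ᶠ b) (oandl o) = there (∈-++⁺ˡ (Occ-closure a o))
  Occ-closure {τ = τ} (a ∧ᶠ b) (oandr o) = there (∈-++⁺ʳ (closure τ a) (Occ-closure b o))
  Occ-closure (◇ a)    (odia o)  = there (Occ-closure a o)
  Occ-closure (□ a)    (obox o)  = there (Occ-closure a o)
  Occ-closure (μ a)    (omu o)   = there (Occ-closure a o)
  Occ-closure (ν a)    (onu o)   = there (Occ-closure a o)

  -- □ ~ ⌜ ψ ⌝ is what makes R^max preserve ◇ ψ.
  literals : Fm → List Fm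
  literals ψ = ⌜ ψ ⌝ ∷ ~ ⌜ ψ ⌝ ∷ □ ⌜ ψ ⌝ ∷ □ (~ ⌜ ψ ⌝) ∷ []

  filter-set : List Fm → List Fm
  filter-set = concatMap literals

  ∈-filter-set : ∀ {Λ} → ψ ∈ Λ → χ ∈ literals ψ → χ ∈ filter-set Λ
  ∈-filter-set m k = ∈-concatMap⁺ literals (lose m k)

  ∈-filter-set⁻ : ∀ {Λ} → χ ∈ filter-set Λ → ∃ λ ψ → ψ ∈ Λ × χ ∈ literals ψ
  ∈-filter-set⁻ m = find (∈-concatMap⁻ literals m)

  -- A fixpoint formula enters only through its name, a variable, so no unfolding is ever called
  -- for.
  filter-set-closed : ∀ Λ → FLClosed (filter-set Λ)
  filter-set-closed Λ φ m with ∈-filter-set⁻ {Λ = Λ} m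
  ... | ψ , k , here refl                         = []
  ... | ψ , k , there (here refl)                 = ∈-filter-set k (here refl) ∷ []
  ... | ψ , k , there (there (here refl))         = ∈-filter-set k (here refl) ∷ []
  ... | ψ , k , there (there (there (here refl))) = ∈-filter-set k (there (here refl)) ∷ []

  filter-set-Basic : ∀ Λ → All Basic (filter-set Λ)
  filter-set-Basic Λ = All.tabulate λ m → case ∈-filter-set⁻ {Λ = Λ} m of λ
    { (ψ , k , here refl)                         → bvar
    ; (ψ , k , there (here refl))                 → bnvar
    ; (ψ , k , there (there (here refl)))         → bbox bvar
    ; (ψ , k , there (there (there (here refl)))) → bbox bnvar }

  -- The truth lemma for the filtration

  module Filtered (Λ : List Fm) (filtration : Filtration lem subframe V (filter-set Λ)) where

    open Filtration filtration

    private module Q = Semantics lem frameΣ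

    private variable
      f : Q → Bool
      ρ : ℕ → Q → Bool

    -- Two halves kept apart, because `Con-lower` and `Cocon-upper` establish one each.
    Lower Upper Agrees : (Q → Bool) → Fm → Set
    Lower  f ψ = ∀ w → w ∋ ψ → T (f (q w))
    Upper  f ψ = ∀ w → T (f (q w)) → w ∋ ψ
    Agrees f ψ = ∀ w → T (f (q w)) ⇔ w ∋ ψ

    q-∋ : ψ ∈ Λ → q w ≡ q u → w ∋ ψ → u ∋ ψ
    q-∋ {w = w} {u} m e = subst T (to (q-ker w u) e _ (∈-filter-set m (here refl)))

    -- The kernel of `q` is agreement in truth on a finite basic set, which `eval-name` turns into
    -- agreement on its translations; hence `f ∘ q` is invariant as `definable` requires.
    definable-Q : ∀ f → ∃ λ γ → WF γ × Agrees f γ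
    definable-Q f = definable (All.map⁺ (All.map sub-name-WF (filter-set-Basic Λ))) (f ∘ q) λ w u e →
      subst (T ∘ f) $ from (q-ker w u) λ φ m →
        let B = All.lookup (filter-set-Basic Λ) m in
        T⇔⇒≡ (⇔-trans (eval-name w B) (⇔-trans (All.lookup (All.map⁻ e) m) (⇔-sym (eval-name u B))))

    extension : Fm → Q → Bool
    extension ψ a = does (lem (∃ λ w → q w ≡ a × w ∋ ψ))

    extension-agrees : ψ ∈ Λ → Agrees (extension ψ) ψ
    extension-agrees m w = mk⇔
      (λ t → case to (T-does (lem _)) t of λ (u , e , p) → q-∋ {w = u} {w} m e p)
      (λ p → from (T-does (lem _)) (w , refl , p))

    max-□ : WF ψ → ψ ∈ Λ → RΣ (q w) (q u) → w ∋ (□ ψ) → u ∋ ψ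
    max-□ {ψ} {w} {u} W m r p = ⊆Rmax _ _ r w u refl refl _ (∈-filter-set m (there (there (here refl)))) $
      from (eval-name w (bbox bvar)) (subst (λ x → w ∋ (□ x)) (sym (name-code W)) p)

    max-◇ : WF ψ → ψ ∈ Λ → RΣ (q w) (q u) → u ∋ ψ → w ∋ (◇ ψ)
    max-◇ {ψ} {w} {u} W m r p = decidable-stable (T? _) λ n → flip (to T-not) p $
      ⊆Rmax _ _ r w u refl refl _ (∈-filter-set m (there (there (there (here refl))))) $
        from (eval-name w (bbox bnvar)) $
          subst (λ x → w ∋ (□ (~ x))) (sym (name-code W)) (from (∋-~ w (wdia W)) n)

    min-R : Rel subframe w u → RΣ (q w) (q u)
    min-R {w} {u} r = Rmin⊆ _ _ (w , u , refl , refl , r)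

    -- `Rmin⊆` speaks of worlds alone, so this clause and `box-upper` reach every well-formed `ψ`;
    -- their two companions go through `⊆Rmax`, which knows only about `Λ`.
    dia-lower : WF ψ → Lower f ψ → Lower (Q.dia f) (◇ ψ)
    dia-lower W h w p = case to (∋-◇ w W) p of λ (u , r , m) →
      from (T-does (lem _)) (q u , min-R {w} {u} r , h u m)

    dia-upper : WF ψ → ψ ∈ Λ → Upper f ψ → Upper (Q.dia f) (◇ ψ)
    dia-upper W m h w t with to (T-does (lem _)) t
    ... | b , r , fb with u , refl ← q-surj b = max-◇ {w = w} {u} W m r (h u fb)

    box-lower : WF ψ → ψ ∈ Λ → Lower f ψ → Lower (Q.box f) (□ ψ)
    box-lower {ψ} {f} W m h w p = from (T-does (lem _)) successors
      where
      successors : ∀ b → RΣ (q w) b → T (f b)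
      successors b r with u , refl ← q-surj b = h u (max-□ {w = w} {u} W m r p)

    box-upper : WF ψ → Upper f ψ → Upper (Q.box f) (□ ψ)
    box-upper W h w t = from (∋-□ w W) λ u r → h u (to (T-does (lem _)) t (q u) (min-R {w} {u} r))

    WF-◂ : WF ψ → (∀ i → WF (τ i)) → ∀ i → WF ((ψ ◂ τ) i)
    WF-◂ W Ws zero    = W
    WF-◂ W Ws (suc i) = Ws i

    module _ {a : Fm} {τ : ℕ → Fm} {ρ : ℕ → Q → Bool}
             (Ws : ∀ i → WF (τ i)) (C : Con only0 a) where

      private
        E : Q → Bool
        E = Q.⟦ μ a ⟧ ρ

        aτ : Fm
        aτ = sub (liftS τ) a

        Cτ : Con only0 aτ
        Cτ = Con-sub-liftS Ws C

        WF-unfold : WF ψ → WF (aτ [ ψ /0])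
        WF-unfold {ψ} W = subst WF (sym (sub-liftS-sub0 τ ψ a)) (WF-sub (WF-◂ W Ws) (Con⇒WF C))

      -- Some γ defines E, and by induction it is a prefixpoint, so the least
      -- prefixpoint rule applies.
      mu-lower : (∀ {γ} → WF γ → Agrees E γ → Lower (Q.⟦ a ⟧ (E ∷ₑ ρ)) (sub (γ ◂ τ) a)) →
                 Lower E (sub τ (μ a))
      mu-lower IH w p = case definable-Q E of λ (γ , Wγ , d) →
        from (d w) $ ∋-mp w (wmu Cτ) Wγ
          (lfp Cτ Wγ $ ∋-complete (wor (WF-negK (WF-unfold Wγ)) Wγ) λ u →
             from (∋-⇒ u (WF-unfold Wγ) Wγ) λ m →
               to (d u) $ Q.μ-prefix C (q u) $ IH Wγ d u $
                 subst (u ∋_) (sub-liftS-sub0 τ γ a) m)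
          p

      -- By the prefixpoint axiom the classes of worlds containing the fixpoint formula form a
      -- prefixpoint, and `E` is below every prefixpoint.
      mu-upper : sub τ (μ a) ∈ Λ →
                 (∀ {Z} → Agrees Z (sub τ (μ a)) → Upper (Q.⟦ a ⟧ (Z ∷ₑ ρ)) (sub (sub τ (μ a) ◂ τ) a)) →
                 Upper E (sub τ (μ a))
      mu-upper m IH w t = to (extension-agrees m w) $ Q.mu-least Z prefixpoint (q w) t
        where
        Z : Q → Bool
        Z = extension (sub τ (μ a))

        prefixpoint : ∀ b → T (Q.⟦ a ⟧ (Z ∷ₑ ρ) b) → T (Z b)
        prefixpoint b s with u , refl ← q-surj b = from (extension-agrees m u) $
          ∋-mp u (WF-unfold (wmu Cτ)) (wmu Cτ) (ax-pre Cτ) $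
            subst (u ∋_) (sym (sub-liftS-sub0 τ (sub τ (μ a)) a)) $ IH (extension-agrees m) u s

    module _ {a : Fm} {τ : ℕ → Fm} {ρ : ℕ → Q → Bool}
             (Ws : ∀ i → WF (τ i)) (C : Cocon only0 a) where

      private
        E : Q → Bool
        E = Q.⟦ ν a ⟧ ρ

        aτ : Fm
        aτ = sub (liftS τ) a

        Cτ : Cocon only0 aτ
        Cτ = Cocon-sub-liftS Ws C

        WF-unfold : WF ψ → WF (aτ [ ψ /0])
        WF-unfold {ψ} W = subst WF (sym (sub-liftS-sub0 τ ψ a)) (WF-sub (WF-◂ W Ws) (Cocon⇒WF C))

      -- The rule `gfp` takes a theorem, so the postfixpoint property of the defining `γ` is checked
      -- at all worlds `u`, and `∋-complete` makes a derivation of it.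
      nu-upper : (∀ {γ} → WF γ → Agrees E γ → Upper (Q.⟦ a ⟧ (E ∷ₑ ρ)) (sub (γ ◂ τ) a)) →
                 Upper E (sub τ (ν a))
      nu-upper IH w t = case definable-Q E of λ (γ , Wγ , d) →
        ∋-mp w Wγ (wnu Cτ)
          (gfp Cτ Wγ $ ∋-complete (wor (WF-negK Wγ) (WF-unfold Wγ)) λ u →
             from (∋-⇒ u Wγ (WF-unfold Wγ)) λ m →
               subst (u ∋_) (sym (sub-liftS-sub0 τ γ a)) $
                 IH Wγ d u $ Q.ν-postfix C (q u) $ from (d u) m)
          (to (d w) t)

      nu-lower : sub τ (ν a) ∈ Λ →
                 (∀ {Z} → Agrees Z (sub τ (ν a)) → Lower (Q.⟦ a ⟧ (Z ∷ₑ ρ)) (sub (sub τ (ν a) ◂ τ) a)) →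
                 Lower E (sub τ (ν a))
      nu-lower m IH w p = Q.nu-greatest Z postfixpoint (q w) (from (extension-agrees m w) p)
        where
        Z : Q → Bool
        Z = extension (sub τ (ν a))

        postfixpoint : ∀ b → T (Z b) → T (Q.⟦ a ⟧ (Z ∷ₑ ρ) b)
        postfixpoint b s with u , refl ← q-surj b = IH (extension-agrees m) u $
          subst (u ∋_) (sub-liftS-sub0 τ (sub τ (ν a)) a) $
            ∋-mp u (wnu Cτ) (WF-unfold (wnu Cτ)) (ax-post Cτ) $ to (extension-agrees m u) s

    -- Restricted to occurring variables: at the top level these are the ones guaranteed to lie in
    -- `Λ`, where `extension` agrees with membership.
    Reads : (ℕ → Q → Bool) → (ℕ → Fm) → Fm → Set
    Reads ρ τ φ = ∀ i → Occ i φ → Agrees (ρ i) (τ i)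

    Reads-∷ : (∀ i → Occ (suc i) a → Agrees (ρ i) (τ i)) → Agrees f ψ → Reads (f ∷ₑ ρ) (ψ ◂ τ) a
    Reads-∷ h e zero    _ = e
    Reads-∷ h e (suc i) o = h i o

    Differ : (ℕ → Bool) → (τ δ : ℕ → Fm) → Set
    Differ X τ δ = ∀ i → X i ≡ false → δ i ≡ τ i

    Differ-◂ : ∀ {γ} → Differ X τ δ → Differ (extB X) (ψ ◂ τ) (γ ◂ δ)
    Differ-◂ h (suc i) = h i

    -- Truth holds for the unfolding τ only.  For continuous formulas, the
    -- inclusion given by R^min survives when δ replaces the unfolding of
    -- the variables in X by arbitrary defining formulas.
    mutual
      truth : ∀ φ τ ρ → WF φ → (∀ i → WF (τ i)) → All (_∈ Λ) (closure τ φ) → Reads ρ τ φ →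
              Agrees (Q.⟦ φ ⟧ ρ) (sub τ φ)
      truth (var i)  τ ρ _ Ws _ h   = h i ovar
      truth (nvar i) τ ρ _ Ws _ h w = ⇔-trans T-not $ ⇔-trans
        (mk⇔ (_∘ from (h i onvar w)) (_∘ to (h i onvar w))) (⇔-sym (∋-~ w (Ws i)))
      truth (a ∨ᶠ b) τ ρ (wor A B) Ws (_ ∷ ms) h w with ka , kb ← ++⁻ (closure τ a) ms =
        ⇔-trans (T-∨ {Q.⟦ a ⟧ ρ (q w)}) $ ⇔-trans
          (truth a τ ρ A Ws ka (λ i → h i ∘ oorl) w ⊎-⇔ truth b τ ρ B Ws kb (λ i → h i ∘ oorr) w)
          (⇔-sym (∋-∨ w (WF-sub Ws A) (WF-sub Ws B)))
      truth (a ∧ᶠ b) τ ρ (wand A B) Ws (_ ∷ ms) h w with ka , kb ← ++⁻ (closure τ a) ms =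
        ⇔-trans (T-∧ {Q.⟦ a ⟧ ρ (q w)}) $ ⇔-trans
          (truth a τ ρ A Ws ka (λ i → h i ∘ oandl) w ×-⇔ truth b τ ρ B Ws kb (λ i → h i ∘ oandr) w)
          (⇔-sym (∋-∧ w (WF-sub Ws A) (WF-sub Ws B)))
      truth (◇ a) τ ρ (wdia A) Ws (_ ∷ ms) h w = mk⇔
        (dia-upper (WF-sub Ws A) (All.head ms) (λ u → to   (truth a τ ρ A Ws ms (λ i → h i ∘ odia) u)) w)
        (dia-lower (WF-sub Ws A)               (λ u → from (truth a τ ρ A Ws ms (λ i → h i ∘ odia) u)) w)
      truth (□ a) τ ρ (wbox A) Ws (_ ∷ ms) h w = mk⇔
        (box-upper (WF-sub Ws A)               (λ u → to   (truth a τ ρ A Ws ms (λ i → h i ∘ obox) u)) w)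
        (box-lower (WF-sub Ws A) (All.head ms) (λ u → from (truth a τ ρ A Ws ms (λ i → h i ∘ obox) u)) w)
      truth (μ a) τ ρ (wmu C) Ws (m ∷ ms) h w = mk⇔
        (mu-upper Ws C m (λ {X} e u → to (truth a _ (X ∷ₑ ρ) (Con⇒WF C) (WF-◂ (WF-sub Ws (wmu C)) Ws) ms
          (Reads-∷ (λ i → h i ∘ omu) e) u)) w)
        -- The body with `γ` need not lie in `Λ`, so `Con-lower` takes the place of a recursive
        -- call. The environments differ at the bound variable alone, `extB none` being `only0`.
        (mu-lower Ws C (λ {γ} W e → Con-lower a _ (γ ◂ τ) _ C (WF-◂ (WF-sub Ws (wmu C)) Ws) (WF-◂ W Ws) ms
          (Differ-◂ {X = none} λ _ _ → refl) (Reads-∷ (λ i → h i ∘ omu) e)) w)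
      truth (ν a) τ ρ (wnu C) Ws (m ∷ ms) h w = mk⇔
        (nu-upper Ws C (λ {γ} W e → Cocon-upper a _ (γ ◂ τ) _ C (WF-◂ (WF-sub Ws (wnu C)) Ws) (WF-◂ W Ws) ms
          (Differ-◂ {X = none} λ _ _ → refl) (Reads-∷ (λ i → h i ∘ onu) e)) w)
        (nu-lower Ws C m (λ {X} e u → from (truth a _ (X ∷ₑ ρ) (Cocon⇒WF C) (WF-◂ (WF-sub Ws (wnu C)) Ws) ms
          (Reads-∷ (λ i → h i ∘ onu) e) u)) w)

      Con-lower : ∀ φ τ δ ρ → Con X φ → (∀ i → WF (τ i)) → (∀ i → WF (δ i)) →
                  All (_∈ Λ) (closure τ φ) → Differ X τ δ → Reads ρ δ φ →
                  Lower (Q.⟦ φ ⟧ ρ) (sub δ φ)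
      -- An `X`-free subformula cannot tell `δ` from `τ`, so the full truth lemma for `τ` applies,
      -- even under □ and ν.
      Con-lower φ τ δ ρ (cfree W f) Ws Wδ ms e h w p =
        from (truth φ τ ρ W Ws ms (λ i o → subst (Agrees (ρ i)) (e i (f i o)) (h i o)) w) $
          subst (w ∋_) (sub-cong-Occ φ λ i o → e i (f i o)) p
      Con-lower (var i) τ δ ρ (cvar _) Ws Wδ ms e h w = from (h i ovar w)
      Con-lower (a ∨ᶠ b) τ δ ρ (cor C D) Ws Wδ (_ ∷ ms) e h w p with ka , kb ← ++⁻ (closure τ a) ms =
        from (T-∨ {Q.⟦ a ⟧ ρ (q w)}) $ Sum.map
          (Con-lower a τ δ ρ C Ws Wδ ka e (λ i → h i ∘ oorl) w)
          (Con-lower b τ δ ρ D Ws Wδ kb e (λ i → h i ∘ oorr) w)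
          (to (∋-∨ w (WF-sub Wδ (Con⇒WF C)) (WF-sub Wδ (Con⇒WF D))) p)
      Con-lower (a ∧ᶠ b) τ δ ρ (cand C D) Ws Wδ (_ ∷ ms) e h w p with ka , kb ← ++⁻ (closure τ a) ms =
        from (T-∧ {Q.⟦ a ⟧ ρ (q w)}) $ Prod.map
          (Con-lower a τ δ ρ C Ws Wδ ka e (λ i → h i ∘ oandl) w)
          (Con-lower b τ δ ρ D Ws Wδ kb e (λ i → h i ∘ oandr) w)
          (to (∋-∧ w (WF-sub Wδ (Con⇒WF C)) (WF-sub Wδ (Con⇒WF D))) p)
      Con-lower (◇ a) τ δ ρ (cdia C) Ws Wδ (_ ∷ ms) e h =
        dia-lower (WF-sub Wδ (Con⇒WF C)) (Con-lower a τ δ ρ C Ws Wδ ms e λ i → h i ∘ odia)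
      -- `τ` gains the true unfolding, which keeps the closure inside `Λ` for later `X`-free parts,
      -- while `δ` gains the defining formula `γ`; so the bound variable joins `X`.
      Con-lower (μ a) τ δ ρ (cmu C) Ws Wδ (_ ∷ ms) e h =
        mu-lower Wδ (Con-⊆ᵇ only0⊆extB C) λ {γ} W d →
          Con-lower a _ (γ ◂ δ) _ C (WF-◂ (WF-sub Ws (Con⇒WF (cmu C))) Ws) (WF-◂ W Wδ) ms
            (Differ-◂ e) (Reads-∷ (λ i → h i ∘ omu) d)

      Cocon-upper : ∀ φ τ δ ρ → Cocon X φ → (∀ i → WF (τ i)) → (∀ i → WF (δ i)) →
                    All (_∈ Λ) (closure τ φ) → Differ X τ δ → Reads ρ δ φ →
                    Upper (Q.⟦ φ ⟧ ρ) (sub δ φ)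
      Cocon-upper φ τ δ ρ (kfree W f) Ws Wδ ms e h w t =
        subst (w ∋_) (sym (sub-cong-Occ φ λ i o → e i (f i o))) $
          to (truth φ τ ρ W Ws ms (λ i o → subst (Agrees (ρ i)) (e i (f i o)) (h i o)) w) t
      Cocon-upper (var i) τ δ ρ (kvar _) Ws Wδ ms e h w = to (h i ovar w)
      Cocon-upper (a ∨ᶠ b) τ δ ρ (kor C D) Ws Wδ (_ ∷ ms) e h w t with ka , kb ← ++⁻ (closure τ a) ms =
        from (∋-∨ w (WF-sub Wδ (Cocon⇒WF C)) (WF-sub Wδ (Cocon⇒WF D))) $ Sum.map
          (Cocon-upper a τ δ ρ C Ws Wδ ka e (λ i → h i ∘ oorl) w)
          (Cocon-upper b τ δ ρ D Ws Wδ kb e (λ i → h i ∘ oorr) w)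
          (to (T-∨ {Q.⟦ a ⟧ ρ (q w)}) t)
      Cocon-upper (a ∧ᶠ b) τ δ ρ (kand C D) Ws Wδ (_ ∷ ms) e h w t with ka , kb ← ++⁻ (closure τ a) ms =
        from (∋-∧ w (WF-sub Wδ (Cocon⇒WF C)) (WF-sub Wδ (Cocon⇒WF D))) $ Prod.map
          (Cocon-upper a τ δ ρ C Ws Wδ ka e (λ i → h i ∘ oandl) w)
          (Cocon-upper b τ δ ρ D Ws Wδ kb e (λ i → h i ∘ oandr) w)
          (to (T-∧ {Q.⟦ a ⟧ ρ (q w)}) t)
      Cocon-upper (□ a) τ δ ρ (kbox C) Ws Wδ (_ ∷ ms) e h =
        box-upper (WF-sub Wδ (Cocon⇒WF C)) (Cocon-upper a τ δ ρ C Ws Wδ ms e λ i → h i ∘ obox)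
      Cocon-upper (ν a) τ δ ρ (knu C) Ws Wδ (_ ∷ ms) e h =
        nu-upper Wδ (Cocon-⊆ᵇ only0⊆extB C) λ {γ} W d →
          Cocon-upper a _ (γ ◂ δ) _ C (WF-◂ (WF-sub Ws (Cocon⇒WF (knu C))) Ws) (WF-◂ W Wδ) ms
            (Differ-◂ e) (Reads-∷ (λ i → h i ∘ onu) d)

  complete : ∀ φ → WF φ → (∀ F → InFr lem L F → Valid lem F φ) → L ⊢ φ
  complete φ W valid
    with fl , fl∈Fr ← filtrable subframe (subframe-InFr basic canonical) V
                        (filter-set (closure var φ)) (filter-set-closed (closure var φ))
                        (filter-set-Basic (closure var φ)) =
    ∋-complete W λ w → subst (w ∋_) (sub-var φ) $
      -- Validity in the frame leaves the valuation free. Here `var i` gets the classes of worlds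
      -- containing its name `⌜ var i ⌝`, whereas in the canonical model `var i` stands for the
      -- formula `name i`.
      to (truth φ var (extension ∘ var) W (λ _ → wvar) (All.tabulate id)
            (λ i o → extension-agrees (Occ-closure φ o)) w)
         (valid (Filtration.frameΣ fl) fl∈Fr (extension ∘ var) (Filtration.q fl w))
    where open Filtered (closure var φ) fl

theorem4p14 : (lem : LEM) (L : Fm → Set) → NormalModalLogic L →
    Canonical lem L → AdmitsFiltration lem L →
    (φ : Fm) → WF φ →
    (L ⊢ φ) ⇔ ((F : Frame) → InFr lem L F → Valid lem F φ)
theorem4p14 lem L N can adm φ W = mk⇔
  (λ p F F∈Fr → Soundness.sound lem L F F∈Fr p)
  (Completeness.complete lem L N can adm φ W)
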